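{- For any connected finite graph $G$ with $n$ vertices, the chromatic symmetric homology $H^{\mathrm{CS}}(G)$ is supported in bigradings $(i,j)$ which satisfy $0\leq i\leq n-1$ and $0\leq j\leq i$; that is, the component of homological degree $i$ and internal degree $j$ vanishes for all other $(i,j)$.
   Context: A finite graph $G=(V,E)$ consists of a finite set $V$ and a set $E$ of 2-element subsets of $V$. Let $n=|V|$ and fix an ordering $e_1,\dots,e_m$ of $E$. $\mathbb{C}[S_n]\text{ - }\mathbf{gmod}$ is the category of graded $\mathbb{C}[S_n]$-modules and degree-preserving homomorphisms. $S^\lambda$ is the irreducible $\mathbb{C}[S_n]$-module indexed by the partition $\lambda\vdash n$. For $n\in\mathbb{N}$, $n\ge1$, let $\mathcal{L}_n$ be the graded $\mathbb{C}[S_n]$-module \[\mathcal{L}_n=\bigwedge\nolimits^{*}S^{(n-1,1)}=\bigoplus_{k=0}^{n-1}\bigwedge\nolimits^{k}S^{(n-1,1)}=\bigoplus_{k=0}^{n-1}S^{(n-k,1^k)}\{k\},\] where $\{k\}$ shifts the grading up by $k$, so the $k$-th exterior power sits in degree $k$ (for $n=1$ this is the trivial module in degree $0$). For $T\subseteq E$, let $B_1,\dots,B_r$ be the vertex sets of the connected components of the spanning subgraph $(V,T)$, $b_i=|B_i|$, and let \[\mathcal{M}_T=\mathrm{Ind}_{S_{B_1}\times\cdots\times S_{B_r}}^{S_{V}}(\mathcal{L}_{b_1}\otimes\cdots\otimes\mathcal{L}_{b_r}),\qquad S_V\cong S_n,\] which depends only on the partition of $V$ into components of $T$. The chromatic symmetric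 functor $F^{\mathrm{CS}}$ is a functor from the Boolean lattice $2^E$ (subsets of $E$ ordered by inclusion, viewed as a category) to $\mathbb{C}[S_n]\text{ - }\mathbf{gmod}$ with $F^{\mathrm{CS}}(T)=\mathcal{M}_T$ and $F^{\mathrm{CS}}(T\lessdot T\cup\{e\})=d_{T\lessdot T\cup\{e\}}:\mathcal{M}_T\to\mathcal{M}_{T\cup\{e\}}$ on cover relations, where $d_{T\lessdot T\cup\{e\}}$ is the identity map whenever adding $e$ to $T$ completes a cycle. When $e$ joins two distinct components, $d_{T\lessdot T\cup\{e\}}$ is a prescribed morphism of graded $\mathbb{C}[S_n]$-modules (the one of Sazdanović and Yip); the statement is to be read for any such choice making $F^{\mathrm{CS}}$ a functor. Let $c(T\lessdot T\cup\{e_i\})=(-1)^{\#\{e_j\in T\,:\,j<i\}}$. The chromatic symmetric homology $H^{\mathrm{CS}}(G)$ is the cohomology of the cochain complex with $C^k=\bigoplus_{|T|=k}F^{\mathrm{CS}}(T)$ and differential $\delta^k=\sum_{T\lessdot T',\,|T|=k}c(T\lessdot T')F^{\mathrm{CS}}(T\lessdot T')$. In the bigrading $(i,j)$, $i$ is the cohomological degree $|T|$ and $j$ is the internal degree of the graded $\mathbb{C}[S_n]$-modules. -}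

module Defs where

open import Algebra.Bundles using (CommutativeMonoid; CommutativeRing; Group)
open import Algebra.Module.Bundles using (LeftModule)
open import Algebra.Morphism.Structures using (IsGroupHomomorphism)
import Algebra.Module.Construct.TensorUnit as TensorUnit
import Algebra.Module.Construct.Zero as Zero
import Algebra.Properties.CommutativeMonoid.Sum as Sum
import Data.Bool.Properties as Bool
open import Data.Fin.Base as Fin using (Fin; zero; suc)
import Data.Fin.Properties as Fin
open import Data.Fin.Permutation as Perm using (Permutation′; _⟨$⟩ʳ_; _⟨$⟩ˡ_; _∘ₚ_)
open import Data.Fin.Subset using (Subset; inside; outside; _∈_; _∉_; _⊆_; _∪_; _-_; ⁅_⁆; ∣_∣)
open import Data.Fin.Subset.Properties
  using (_∈?_; drop-there; x∈p∪q⁻; x∈⁅y⁆⇒x≡y; p⊆p∪q; p─q⊆p; p─⊥≡p)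
open import Data.Integer.Base as ℤ using (ℤ; +_; -[1+_])
import Data.Integer.Properties as ℤ
open import Data.Irrelevant using ([_])
open import Data.List.Base as List using (List; []; _∷_; allFin; deduplicate; filter; length)
import Data.List.Properties as List
open import Data.List.Relation.Unary.All using (All; []; _∷_)
open import Data.Nat.Base as ℕ using (ℕ; zero; suc; _⊓_; _⊔_)
import Data.Nat.Properties as ℕ
open import Data.Product.Base using (Σ-syntax; ∃-syntax; _×_; _,_; proj₁; proj₂)
open import Data.Rational.Base as ℚ using (ℚ; 0ℚ; 1ℚ; ½; Positive; 1/_)
import Data.Rational.Properties as ℚ
open import Data.Rational.Solver using (module +-*-Solver)
open import Data.Refinement.Base using (Refinement-syntax; _,_; value)
open import Data.Sum.Base using (_⊎_; inj₁; inj₂; [_,_]′)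
open import Data.Unit.Polymorphic.Base using (tt)
open import Data.Vec.Base as Vec using (Vec; []; _∷_; _[_]≔_; lookup; tabulate; here; there)
import Data.Vec.Properties as Vec
open import Data.Vec.Relation.Binary.Pointwise.Inductive as Pointwise using (Pointwise; []; _∷_)
open import Function.Base using (_∘_; id)
open import Function.Bundles using (_⇔_; mk⇔; Equivalence)
open import Level using (0ℓ)
open import Relation.Binary.Construct.Closure.ReflexiveTransitive
  using (Star; _◅_; _◅◅_) renaming (ε to stop)
open import Relation.Binary.PropositionalEquality
  using (_≡_; _≢_; refl; sym; trans; cong; subst; subst₂)
open import Relation.Binary.Structures using (IsEquivalence)
open import Relation.Nullary.Decidable
  using (Dec; yes; no; does; map′; _⊎-dec_; _×-dec_; does-⇔)

-- `Small size f`: f i → 0 as size i → ∞.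
Small : {I : Set} → (I → ℕ) → (I → ℚ) → Set
Small {I} size f =
  ∀ ε → 0ℚ ℚ.< ε → ∃[ N ] (∀ i → N ℕ.≤ size i → ℚ.∣ f i ∣ ℚ.< ε)

-- Real numbers as Cauchy sequences of rationals, equal when their difference
-- tends to 0.
record ℝ : Set where
  field
    seq    : ℕ → ℚ
    cauchy : Small {ℕ × ℕ} (λ (k , l) → k ⊓ l) (λ (k , l) → seq k ℚ.- seq l)

open ℝ

infix 4 _≃_
_≃_ : ℝ → ℝ → Set
x ≃ y = Small id (λ k → seq x k ℚ.- seq y k)

module _ {I : Set} {size : I → ℕ} where

  private variable
    f g h : I → ℚ

  small-≗ : (∀ i → f i ≡ g i) → Small size f → Small size g
  small-≗ f≗g s ε ε>0 = let N , p = s ε ε>0 in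
    N , λ i N≤i → subst (λ q → ℚ.∣ q ∣ ℚ.< ε) (f≗g i) (p i N≤i)

  small-0 : (∀ i → f i ≡ 0ℚ) → Small size f
  small-0 f≗0 ε ε>0 = 0 , λ i _ → subst (λ q → ℚ.∣ q ∣ ℚ.< ε) (sym (f≗0 i)) ε>0

  small-neg : Small size f → Small size (λ i → ℚ.- f i)
  small-neg {f} s ε ε>0 = let N , p = s ε ε>0 in
    N , λ i N≤i → subst (ℚ._< ε) (sym (ℚ.∣-p∣≡∣p∣ (f i))) (p i N≤i)

  small-+ : Small size f → Small size g → Small size (λ i → f i ℚ.+ g i)
  small-+ {f} {g} s t ε ε>0 =
    let M , p = s δ δ>0
        N , q = t δ δ>0
    in M ⊔ N , λ i M⊔N≤i → begin-strict
      ℚ.∣ f i ℚ.+ g i ∣      ≤⟨ ℚ.∣p+q∣≤∣p∣+∣q∣ (f i) (g i) ⟩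
      ℚ.∣ f i ∣ ℚ.+ ℚ.∣ g i ∣  <⟨ ℚ.+-mono-< (p i (ℕ.m⊔n≤o⇒m≤o M N M⊔N≤i))
                                        (q i (ℕ.m⊔n≤o⇒n≤o M N M⊔N≤i)) ⟩
      δ ℚ.+ δ              ≡⟨ ℚ.*-distribˡ-+ ε ½ ½ ⟨
      ε ℚ.* 1ℚ             ≡⟨ ℚ.*-identityʳ ε ⟩
      ε                    ∎
    where
    open ℚ.≤-Reasoning
    δ = ε ℚ.* ½
    δ>0 : 0ℚ ℚ.< δ
    δ>0 = subst (ℚ._< δ) (ℚ.*-zeroˡ ½) (ℚ.*-monoˡ-<-pos ½ ε>0)

  Bounded : (I → ℚ) → Set
  Bounded f = Σ[ B ∈ ℚ ] Positive B × ∃[ N ] (∀ i → N ℕ.≤ size i → ℚ.∣ f i ∣ ℚ.≤ B)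

  small-* : Bounded f → Small size g → Small size (λ i → f i ℚ.* g i)
  small-* {f} {g} (B , B+ , M , b) s ε ε>0 =
    let N , p = s δ δ>0 in
    M ⊔ N , λ i M⊔N≤i → begin-strict
      ℚ.∣ f i ℚ.* g i ∣      ≡⟨ ℚ.∣p*q∣≡∣p∣*∣q∣ (f i) (g i) ⟩
      ℚ.∣ f i ∣ ℚ.* ℚ.∣ g i ∣  ≤⟨ ℚ.*-monoʳ-≤-nonNeg ℚ.∣ g i ∣
                                {{ℚ.nonNegative (ℚ.0≤∣p∣ (g i))}}
                                (b i (ℕ.m⊔n≤o⇒m≤o M N M⊔N≤i)) ⟩
      B ℚ.* ℚ.∣ g i ∣        <⟨ ℚ.*-monoʳ-<-pos B (p i (ℕ.m⊔n≤o⇒n≤o M N M⊔N≤i)) ⟩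
      B ℚ.* (B⁻¹ ℚ.* ε)    ≡⟨ ℚ.*-assoc B B⁻¹ ε ⟨
      (B ℚ.* B⁻¹) ℚ.* ε    ≡⟨ cong (ℚ._* ε) (ℚ.*-inverseʳ B) ⟩
      1ℚ ℚ.* ε             ≡⟨ ℚ.*-identityˡ ε ⟩
      ε                    ∎
    where
    open ℚ.≤-Reasoning
    instance
      B-pos : Positive B
      B-pos = B+
      B-nz = ℚ.pos⇒nonZero B
    B⁻¹ = 1/ B
    instance
      B⁻¹-pos : Positive B⁻¹
      B⁻¹-pos = ℚ.1/pos⇒pos B
    δ = B⁻¹ ℚ.* ε
    δ>0 : 0ℚ ℚ.< δ
    δ>0 = subst (ℚ._< δ) (ℚ.*-zeroʳ B⁻¹) (ℚ.*-monoʳ-<-pos B⁻¹ ε>0)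

bounded : ∀ {I : Set} (size : I → ℕ) (x : ℝ) (k : I → ℕ) →
          (∀ i → size i ℕ.≤ k i) → Bounded {size = size} (λ i → seq x (k i))
bounded size x k size≤k =
  let N , p = cauchy x 1ℚ (ℚ.positive⁻¹ 1ℚ)
      a     = ℚ.∣ seq x N ∣
  in 1ℚ ℚ.+ a
   , ℚ.pos+nonNeg⇒pos 1ℚ a {{ℚ.nonNegative (ℚ.0≤∣p∣ (seq x N))}}
   , N
   , λ i N≤i → let b = seq x (k i) in begin
       ℚ.∣ b ∣                             ≡⟨ cong ℚ.∣_∣ (lem b (seq x N)) ⟩
       ℚ.∣ (b ℚ.- seq x N) ℚ.+ seq x N ∣   ≤⟨ ℚ.∣p+q∣≤∣p∣+∣q∣ (b ℚ.- seq x N) (seq x N) ⟩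
       ℚ.∣ b ℚ.- seq x N ∣ ℚ.+ a           ≤⟨ ℚ.+-monoˡ-≤ a (ℚ.<⇒≤ (p (k i , N)
                                             (ℕ.⊓-glb (ℕ.≤-trans N≤i (size≤k i)) ℕ.≤-refl))) ⟩
       1ℚ ℚ.+ a                          ∎
  where
  open ℚ.≤-Reasoning
  open +-*-Solver
  lem : ∀ b c → b ≡ (b ℚ.- c) ℚ.+ c
  lem = solve 2 (λ b c → b := (b :- c) :+ c) refl

module _ where
  open +-*-Solver

  infixl 6 _+ᴿ_
  infixl 7 _*ᴿ_
  infix  8 -ᴿ_

  _+ᴿ_ _*ᴿ_ : ℝ → ℝ → ℝ
  -ᴿ_ : ℝ → ℝ

  x +ᴿ y = record
    { seq    = λ k → seq x k ℚ.+ seq y k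
    ; cauchy = small-≗ (λ (k , l) → lem (seq x k) (seq x l) (seq y k) (seq y l))
                       (small-+ (cauchy x) (cauchy y))
    }
    where
    lem : ∀ a a′ b b′ → (a ℚ.- a′) ℚ.+ (b ℚ.- b′) ≡ (a ℚ.+ b) ℚ.- (a′ ℚ.+ b′)
    lem = solve 4 (λ a a′ b b′ → (a :- a′) :+ (b :- b′) := (a :+ b) :- (a′ :+ b′)) refl

  x *ᴿ y = record
    { seq    = λ k → seq x k ℚ.* seq y k
    ; cauchy = small-≗ (λ (k , l) → lem (seq x k) (seq x l) (seq y k) (seq y l))
                 (small-+ (small-* (bounded _ x proj₁ λ (k , l) → ℕ.m⊓n≤m k l) (cauchy y))
                          (small-* (bounded _ y proj₂ λ (k , l) → ℕ.m⊓n≤n k l) (cauchy x)))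
    }
    where
    lem : ∀ a a′ b b′ →
          a ℚ.* (b ℚ.- b′) ℚ.+ b′ ℚ.* (a ℚ.- a′) ≡ (a ℚ.* b) ℚ.- (a′ ℚ.* b′)
    lem = solve 4 (λ a a′ b b′ →
                     a :* (b :- b′) :+ b′ :* (a :- a′) := (a :* b) :- (a′ :* b′)) refl

  -ᴿ x = record
    { seq    = λ k → ℚ.- seq x k
    ; cauchy = small-≗ (λ (k , l) → lem (seq x k) (seq x l)) (small-neg (cauchy x))
    }
    where
    lem : ∀ a a′ → ℚ.- (a ℚ.- a′) ≡ (ℚ.- a) ℚ.- (ℚ.- a′)
    lem = solve 2 (λ a a′ → :- (a :- a′) := (:- a) :- (:- a′)) refl

  fromℚ : ℚ → ℝ
  fromℚ q = record { seq = λ _ → q ; cauchy = small-0 λ _ → ℚ.+-inverseʳ q }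

  ≗⇒≃ : ∀ {x y} → (∀ k → seq x k ≡ seq y k) → x ≃ y
  ≗⇒≃ {x} {y} x≗y = small-0 λ k →
    trans (cong (ℚ._- seq y k) (x≗y k)) (ℚ.+-inverseʳ (seq y k))

  ≃-isEquivalence : IsEquivalence _≃_
  ≃-isEquivalence = record
    { refl  = λ {x} → ≗⇒≃ {x} {x} λ _ → refl
    ; sym   = λ {x} {y} x≃y →
        small-≗ (λ k → solve 2 (λ a b → :- (a :- b) := b :- a) refl (seq x k) (seq y k))
                (small-neg x≃y)
    ; trans = λ {x} {y} {z} x≃y y≃z →
        small-≗ (λ k → solve 3 (λ a b c → (a :- b) :+ (b :- c) := a :- c) refl
                         (seq x k) (seq y k) (seq z k))
                (small-+ x≃y y≃z)
    }

  +ᴿ-cong : ∀ {x x′ y y′} → x ≃ x′ → y ≃ y′ → x +ᴿ y ≃ x′ +ᴿ y′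
  +ᴿ-cong {x} {x′} {y} {y′} p q = small-≗
    (λ k → solve 4 (λ a a′ b b′ → (a :- a′) :+ (b :- b′) := (a :+ b) :- (a′ :+ b′)) refl
             (seq x k) (seq x′ k) (seq y k) (seq y′ k))
    (small-+ p q)

  *ᴿ-cong : ∀ {x x′ y y′} → x ≃ x′ → y ≃ y′ → x *ᴿ y ≃ x′ *ᴿ y′
  *ᴿ-cong {x} {x′} {y} {y′} p q = small-≗
    (λ k → solve 4 (λ a a′ b b′ →
                      a :* (b :- b′) :+ b′ :* (a :- a′) := (a :* b) :- (a′ :* b′)) refl
             (seq x k) (seq x′ k) (seq y k) (seq y′ k))
    (small-+ (small-* (bounded id x id λ _ → ℕ.≤-refl) q)
             (small-* (bounded id y′ id λ _ → ℕ.≤-refl) p))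

  -ᴿ-cong : ∀ {x x′} → x ≃ x′ → -ᴿ x ≃ -ᴿ x′
  -ᴿ-cong {x} {x′} p = small-≗
    (λ k → solve 2 (λ a a′ → :- (a :- a′) := (:- a) :- (:- a′)) refl (seq x k) (seq x′ k))
    (small-neg p)

record Complex : Set where
  constructor _+i_
  field
    re im : ℝ

open Complex

infix 4 _≈ᶜ_
record _≈ᶜ_ (z w : Complex) : Set where
  constructor _,_
  field
    re≃ : re z ≃ re w
    im≃ : im z ≃ im w

ℂ : CommutativeRing 0ℓ 0ℓ
ℂ = record
  { Carrier = Complex
  ; _≈_     = _≈ᶜ_
  ; _+_     = λ z w → (re z +ᴿ re w) +i (im z +ᴿ im w)
  ; _*_     = λ z w → (re z *ᴿ re w +ᴿ -ᴿ (im z *ᴿ im w)) +i (re z *ᴿ im w +ᴿ im z *ᴿ re w)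
  ; -_      = λ z → (-ᴿ re z) +i (-ᴿ im z)
  ; 0#      = fromℚ 0ℚ +i fromℚ 0ℚ
  ; 1#      = fromℚ 1ℚ +i fromℚ 0ℚ
  ; isCommutativeRing = record
    { isRing = record
      { +-isAbelianGroup = record
        { isGroup = record
          { isMonoid = record
            { isSemigroup = record
              { isMagma = record
                { isEquivalence = record
                  { refl  = λ {z} → ≃.refl {re z} , ≃.refl {im z}
                  ; sym   = λ {z} {w} (p , q) →
                      ≃.sym {re z} {re w} p , ≃.sym {im z} {im w} q
                  ; trans = λ {z} {w} {v} (p , q) (p′ , q′) →
                      ≃.trans {re z} {re w} {re v} p p′ , ≃.trans {im z} {im w} {im v} q q′
                  }
                ; ∙-cong = λ {z} {z′} {w} {w′} (p , q) (p′ , q′) →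
                    +ᴿ-cong {re z} {re z′} {re w} {re w′} p p′ ,
                    +ᴿ-cong {im z} {im z′} {im w} {im w′} q q′
                }
              ; assoc = λ z w v → pw (λ k → ℚ.+-assoc (re z at k) (re w at k) (re v at k))
                                     (λ k → ℚ.+-assoc (im z at k) (im w at k) (im v at k))
              }
            ; identity = (λ z → pw (λ k → ℚ.+-identityˡ (re z at k)) (λ k → ℚ.+-identityˡ (im z at k)))
                       , (λ z → pw (λ k → ℚ.+-identityʳ (re z at k)) (λ k → ℚ.+-identityʳ (im z at k)))
            }
          ; inverse = (λ z → pw (λ k → ℚ.+-inverseˡ (re z at k)) (λ k → ℚ.+-inverseˡ (im z at k)))
                    , (λ z → pw (λ k → ℚ.+-inverseʳ (re z at k)) (λ k → ℚ.+-inverseʳ (im z at k)))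
          ; ⁻¹-cong = λ {z} {z′} (p , q) → -ᴿ-cong {re z} {re z′} p , -ᴿ-cong {im z} {im z′} q
          }
        ; comm = λ z w → pw (λ k → ℚ.+-comm (re z at k) (re w at k))
                            (λ k → ℚ.+-comm (im z at k) (im w at k))
        }
      ; *-cong = λ {z} {z′} {w} {w′} (p , q) (p′ , q′) →
          +ᴿ-cong {re z *ᴿ re w} {re z′ *ᴿ re w′} { -ᴿ (im z *ᴿ im w)} { -ᴿ (im z′ *ᴿ im w′)}
            (*ᴿ-cong {re z} {re z′} {re w} {re w′} p p′)
            (-ᴿ-cong {im z *ᴿ im w} {im z′ *ᴿ im w′}
              (*ᴿ-cong {im z} {im z′} {im w} {im w′} q q′)) ,
          +ᴿ-cong {re z *ᴿ im w} {re z′ *ᴿ im w′} {im z *ᴿ re w} {im z′ *ᴿ re w′}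
            (*ᴿ-cong {re z} {re z′} {im w} {im w′} p q′)
            (*ᴿ-cong {im z} {im z′} {re w} {re w′} q p′)
      ; *-assoc = λ z w v → pw
          (λ k → solve 6 (λ a b c d e f →
             (a :* c :- b :* d) :* e :- (a :* d :+ b :* c) :* f :=
             a :* (c :* e :- d :* f) :- b :* (c :* f :+ d :* e)) refl
             (re z at k) (im z at k) (re w at k) (im w at k) (re v at k) (im v at k))
          (λ k → solve 6 (λ a b c d e f →
             (a :* c :- b :* d) :* f :+ (a :* d :+ b :* c) :* e :=
             a :* (c :* f :+ d :* e) :+ b :* (c :* e :- d :* f)) refl
             (re z at k) (im z at k) (re w at k) (im w at k) (re v at k) (im v at k))
      ; *-identity =
          (λ z → pw
            (λ k → solve 2 (λ a b → con 1ℚ :* a :- con 0ℚ :* b := a) refl (re z at k) (im z at k))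
            (λ k → solve 2 (λ a b → con 1ℚ :* b :+ con 0ℚ :* a := b) refl (re z at k) (im z at k))) ,
          (λ z → pw
            (λ k → solve 2 (λ a b → a :* con 1ℚ :- b :* con 0ℚ := a) refl (re z at k) (im z at k))
            (λ k → solve 2 (λ a b → a :* con 0ℚ :+ b :* con 1ℚ := b) refl (re z at k) (im z at k)))
      ; distrib =
          (λ z w v → pw
            (λ k → solve 6 (λ a b c d e f →
               a :* (c :+ e) :- b :* (d :+ f) := (a :* c :- b :* d) :+ (a :* e :- b :* f)) refl
               (re z at k) (im z at k) (re w at k) (im w at k) (re v at k) (im v at k))
            (λ k → solve 6 (λ a b c d e f →
               a :* (d :+ f) :+ b :* (c :+ e) := (a :* d :+ b :* c) :+ (a :* f :+ b :* e)) refl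
               (re z at k) (im z at k) (re w at k) (im w at k) (re v at k) (im v at k))) ,
          (λ z w v → pw
            (λ k → solve 6 (λ a b c d e f →
               (c :+ e) :* a :- (d :+ f) :* b := (c :* a :- d :* b) :+ (e :* a :- f :* b)) refl
               (re z at k) (im z at k) (re w at k) (im w at k) (re v at k) (im v at k))
            (λ k → solve 6 (λ a b c d e f →
               (c :+ e) :* b :+ (d :+ f) :* a := (c :* b :+ d :* a) :+ (e :* b :+ f :* a)) refl
               (re z at k) (im z at k) (re w at k) (im w at k) (re v at k) (im v at k)))
      }
    ; *-comm = λ z w → pw
        (λ k → solve 4 (λ a b c d → a :* c :- b :* d := c :* a :- d :* b) refl
           (re z at k) (im z at k) (re w at k) (im w at k))
        (λ k → solve 4 (λ a b c d → a :* d :+ b :* c := c :* b :+ d :* a) refl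
           (re z at k) (im z at k) (re w at k) (im w at k))
    }
  }
  where
  open +-*-Solver
  module ≃ = IsEquivalence ≃-isEquivalence

  _at_ : ℝ → ℕ → ℚ
  x at k = seq x k

  pw : ∀ {z w} → (∀ k → re z at k ≡ re w at k) → (∀ k → im z at k ≡ im w at k) →
       z ≈ᶜ w
  pw {z} {w} p q = ≗⇒≃ {re z} {re w} p , ≗⇒≃ {im z} {im w} q

-- Vertices are Fin n; the edges e₁,…,eₘ are pairwise distinct 2-element subsets.
record Graph (n : ℕ) : Set where
  field
    m              : ℕ
    edge           : Fin m → Subset n
    edge-size      : ∀ e → ∣ edge e ∣ ≡ 2
    edge-injective : ∀ {e f} → edge e ≡ edge f → e ≡ f

module _ {n : ℕ} where

  Adjacent : ∀ {m} (edge : Fin m → Subset n) (T : Subset m) (u v : Fin n) → Set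
  Adjacent edge T u v = ∃[ e ] e ∈ T × u ∈ edge e × v ∈ edge e

  Joined : ∀ {m} (edge : Fin m → Subset n) (T : Subset m) (u v : Fin n) → Set
  Joined edge T = Star (Adjacent edge T)

  joined? : ∀ {m} (edge : Fin m → Subset n) (T : Subset m) u v → Dec (Joined edge T u v)
  joined? edge [] u v = map′ (λ { refl → stop }) (λ { stop → refl ; ((() , _) ◅ _) }) (u Fin.≟ v)
  joined? {suc m} edge (b ∷ T) u v = go b
    where
    J : Fin n → Fin n → Set
    J = Joined (edge ∘ suc) T

    Through : Fin n → Fin n → Set
    Through u v = ∃[ x ] ∃[ y ] J u x × x ∈ edge zero × y ∈ edge zero × J y v

    weaken : ∀ {b u v} → J u v → Joined edge (b ∷ T) u v
    weaken stop                        = stop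
    weaken ((e , e∈T , u∈ , w∈) ◅ p) = (suc e , there e∈T , u∈ , w∈) ◅ weaken p

    sound : ∀ {u v} → J u v ⊎ Through u v → Joined edge (inside ∷ T) u v
    sound (inj₁ p)                         = weaken p
    sound (inj₂ (x , y , p , x∈ , y∈ , q)) =
      weaken p ◅◅ (zero , here , x∈ , y∈) ◅ weaken q

    complete : ∀ {u v} → Joined edge (inside ∷ T) u v → J u v ⊎ Through u v
    complete stop = inj₁ stop
    complete ((zero , _ , u∈ , w∈) ◅ p) = inj₂
      ([ (λ q → _ , _ , stop , u∈ , w∈ , q)
       , (λ (x , y , _ , _ , y∈ , q) → _ , y , stop , u∈ , y∈ , q) ]′ (complete p))
    complete ((suc e , e∈T , u∈ , w∈) ◅ p) = [ inj₁ ∘ (s ◅_)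
      , (λ (x , y , q , r) → inj₂ (x , y , s ◅ q , r)) ]′ (complete p)
      where s = e , drop-there e∈T , u∈ , w∈

    strengthen : ∀ {u v} → Joined edge (outside ∷ T) u v → J u v
    strengthen stop                              = stop
    strengthen ((suc e , e∈T , u∈ , w∈) ◅ p) = (e , drop-there e∈T , u∈ , w∈) ◅ strengthen p

    J? : ∀ u v → Dec (J u v)
    J? = joined? (edge ∘ suc) T

    go : ∀ b → Dec (Joined edge (b ∷ T) u v)
    go outside = map′ weaken strengthen (J? u v)
    go inside  = map′ sound complete
      (J? u v ⊎-dec Fin.any? λ x → Fin.any? λ y →
        J? u x ×-dec x ∈? edge zero ×-dec y ∈? edge zero ×-dec J? y v)

module _ {n : ℕ} (G : Graph n) where
  open Graph G

  record Connected : Set where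
    field
      nonempty : Fin n
      joined   : ∀ u v → Joined edge (tabulate λ _ → inside) u v

  component : Subset m → Fin n → Subset n
  component T u = tabulate λ v → does (joined? edge T u v)

  -- The vertex sets B₁,…,Bᵣ of the connected components of (V,T), each listed once.
  blocks : Subset m → List (Subset n)
  blocks T = deduplicate (Vec.≡-dec Bool._≟_) (List.map (component T) (allFin n))

  -- e ∉ T completes a cycle when T already contains a path between the ends of e.
  CompletesCycle : Subset m → Fin m → Set
  CompletesCycle T e = ∀ {u v} → u ∈ edge e → v ∈ edge e → Joined edge T u v

  completesCycle⇒blocks≡ : ∀ {T e} → CompletesCycle T e → blocks T ≡ blocks (T ∪ ⁅ e ⁆)
  completesCycle⇒blocks≡ {T} {e} cyc = cong (deduplicate _)
    (List.map-cong (λ u → Vec.tabulate-cong λ v →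
      does-⇔ (mk⇔ to from) (joined? edge T u v) (joined? edge (T ∪ ⁅ e ⁆) u v))
      (allFin n))
    where
    to : ∀ {u v} → Joined edge T u v → Joined edge (T ∪ ⁅ e ⁆) u v
    to stop                           = stop
    to ((f , f∈T , u∈ , w∈) ◅ p) = (f , p⊆p∪q ⁅ e ⁆ f∈T , u∈ , w∈) ◅ to p

    from : ∀ {u v} → Joined edge (T ∪ ⁅ e ⁆) u v → Joined edge T u v
    from stop = stop
    from ((f , f∈ , u∈ , w∈) ◅ p) with x∈p∪q⁻ T ⁅ e ⁆ f∈
    ... | inj₁ f∈T = (f , f∈T , u∈ , w∈) ◅ from p
    ... | inj₂ f∈e with x∈⁅y⁆⇒x≡y e f∈e
    ...   | refl = cyc u∈ w∈ ◅◅ from p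

OfSize : ℕ → ℤ → Set
OfSize m i = [ T ∈ Subset m ∣ + ∣ T ∣ ≡ i ]

∣T∣≡1+∣T-e∣ : ∀ {m} (T : Subset m) {e} → e ∈ T → ∣ T ∣ ≡ suc ∣ T - e ∣
∣T∣≡1+∣T-e∣ (_ ∷ T)       here        = cong (suc ∘ ∣_∣) (sym (p─⊥≡p T))
∣T∣≡1+∣T-e∣ (inside ∷ T)  (there e∈T) = cong suc (∣T∣≡1+∣T-e∣ T e∈T)
∣T∣≡1+∣T-e∣ (outside ∷ T) (there e∈T) = ∣T∣≡1+∣T-e∣ T e∈T

remove : ∀ {m i} (T : Subset m) → + ∣ T ∣ ≡ ℤ.suc i → ∀ {e} → e ∈ T → + ∣ T - e ∣ ≡ i
remove {_} {i} T p {e} e∈T = trans (sym (ℤ.pred-suc (+ ∣ T - e ∣)))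
  (trans (cong ℤ.pred (trans (cong +_ (sym (∣T∣≡1+∣T-e∣ T e∈T))) p)) (ℤ.pred-suc i))

Sym : ℕ → Group 0ℓ 0ℓ
Sym n = record
  { Carrier = Permutation′ n
  ; _≈_     = Perm._≈_
  ; _∙_     = λ σ τ → τ ∘ₚ σ
  ; ε       = Perm.id
  ; _⁻¹     = Perm.flip
  ; isGroup = record
    { isMonoid = record
      { isSemigroup = record
        { isMagma = record
          { isEquivalence = record
            { refl  = λ _ → refl
            ; sym   = λ p x → sym (p x)
            ; trans = λ p q x → trans (p x) (q x)
            }
          ; ∙-cong = λ {σ} {_} {_} {τ′} p q x → trans (cong (σ ⟨$⟩ʳ_) (q x)) (p (τ′ ⟨$⟩ʳ x))
          }
        ; assoc = λ _ _ _ _ → refl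
        }
      ; identity = (λ _ _ → refl) , (λ _ _ → refl)
      }
    ; inverse = (λ σ _ → Perm.inverseˡ σ) , (λ σ _ → Perm.inverseʳ σ)
    ; ⁻¹-cong = λ {σ} {τ} p x → flip-cong σ τ p x
    }
  }
  where
  flip-cong : ∀ {n} (σ τ : Permutation′ n) → σ Perm.≈ τ → ∀ x → σ ⟨$⟩ˡ x ≡ τ ⟨$⟩ˡ x
  flip-cong σ τ p x = trans
    (cong (σ ⟨$⟩ˡ_) (trans (sym (Perm.inverseʳ τ)) (sym (p (τ ⟨$⟩ˡ x)))))
    (Perm.inverseˡ σ)

Preserves : ∀ {n} → Permutation′ n → Subset n → Set
Preserves σ B = ∀ x → x ∈ B ⇔ (σ ⟨$⟩ʳ x) ∈ B

-- For a set partition P of Fin n with blocks B₁,…,Bᵣ this is S_B₁ × ⋯ × S_Bᵣ ≤ Sₙ.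
-- For a single set B, Young (B ∷ []) is the setwise stabiliser S_B × S_(V∖B), which
-- acts on modules built from B through its restriction to S_B.
Young : ∀ {n} → List (Subset n) → Group 0ℓ 0ℓ
Young {n} P = record
  { Carrier = Σ[ σ ∈ Permutation′ n ] All (Preserves σ) P
  ; _≈_     = λ σ τ → proj₁ σ S.≈ proj₁ τ
  ; _∙_     = λ σ τ → proj₁ σ S.∙ proj₁ τ , ∙-pres {proj₁ σ} {proj₁ τ} (proj₂ σ) (proj₂ τ)
  ; ε       = S.ε , ε-pres
  ; _⁻¹     = λ σ → proj₁ σ S.⁻¹ , ⁻¹-pres {proj₁ σ} (proj₂ σ)
  ; isGroup = record
    { isMonoid = record
      { isSemigroup = record
        { isMagma = record
          { isEquivalence = record
            { refl  = λ {σ} → S.refl {proj₁ σ}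
            ; sym   = λ {σ} {τ} → S.sym {proj₁ σ} {proj₁ τ}
            ; trans = λ {σ} {τ} {ρ} → S.trans {proj₁ σ} {proj₁ τ} {proj₁ ρ}
            }
          ; ∙-cong = λ {σ} {σ′} {τ} {τ′} →
              S.∙-cong {proj₁ σ} {proj₁ σ′} {proj₁ τ} {proj₁ τ′}
          }
        ; assoc = λ σ τ ρ → S.assoc (proj₁ σ) (proj₁ τ) (proj₁ ρ)
        }
      ; identity = (λ σ → S.identityˡ (proj₁ σ)) , (λ σ → S.identityʳ (proj₁ σ))
      }
    ; inverse = (λ σ → S.inverseˡ (proj₁ σ)) , (λ σ → S.inverseʳ (proj₁ σ))
    ; ⁻¹-cong = λ {σ} {τ} → S.⁻¹-cong {proj₁ σ} {proj₁ τ}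
    }
  }
  where
  module S = Group (Sym n)
  open Equivalence

  ∙-pres : ∀ {σ τ} {P : List (Subset n)} →
           All (Preserves σ) P → All (Preserves τ) P → All (Preserves (σ S.∙ τ)) P
  ∙-pres         []       []       = []
  ∙-pres {σ} {τ} (p ∷ ps) (q ∷ qs) =
    (λ x → mk⇔ (to (p (τ ⟨$⟩ʳ x)) ∘ to (q x)) (from (q x) ∘ from (p (τ ⟨$⟩ʳ x)))) ∷
    ∙-pres {σ} {τ} ps qs

  ε-pres : ∀ {P : List (Subset n)} → All (Preserves S.ε) P
  ε-pres {[]}    = []
  ε-pres {_ ∷ _} = (λ _ → mk⇔ id id) ∷ ε-pres

  ⁻¹-pres : ∀ {σ} {P : List (Subset n)} → All (Preserves σ) P → All (Preserves (σ S.⁻¹)) P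
  ⁻¹-pres     []                 = []
  ⁻¹-pres {σ} (_∷_ {B} p ps) =
    (λ x → mk⇔ (λ x∈B → from (p (σ ⟨$⟩ˡ x)) (subst (_∈ B) (sym (Perm.inverseʳ σ)) x∈B))
               (λ y∈B → subst (_∈ B) (Perm.inverseʳ σ) (to (p (σ ⟨$⟩ˡ x)) y∈B))) ∷
    ⁻¹-pres {σ} ps

record GroupHom (H G : Group 0ℓ 0ℓ) : Set where
  private
    module H = Group H
    module G = Group G
  field
    ⟦_⟧                 : H.Carrier → G.Carrier
    isGroupHomomorphism : IsGroupHomomorphism H.rawGroup G.rawGroup ⟦_⟧
  open IsGroupHomomorphism isGroupHomomorphism public

module _ {n : ℕ} where

  private
    youngHom : ∀ {P Q : List (Subset n)} →
               (∀ {σ} → All (Preserves σ) P → All (Preserves σ) Q) →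
               GroupHom (Young P) (Young Q)
    youngHom {P} {Q} f = record
      { ⟦_⟧                 = λ (σ , p) → σ , f {σ} p
      ; isGroupHomomorphism = record
        { isMonoidHomomorphism = record
          { isMagmaHomomorphism = record
            { isRelHomomorphism = record { cong = id }
            ; homo              = λ _ _ _ → refl
            }
          ; ε-homo = λ _ → refl
          }
        ; ⁻¹-homo = λ _ _ → refl
        }
      }

  restrictHead : ∀ {B} {P : List (Subset n)} → GroupHom (Young (B ∷ P)) (Young (B ∷ []))
  restrictHead = youngHom λ { (p ∷ _) → p ∷ [] }

  restrictTail : ∀ {B} {P : List (Subset n)} → GroupHom (Young (B ∷ P)) (Young P)
  restrictTail = youngHom λ { (_ ∷ ps) → ps }

  inclusion : (P : List (Subset n)) → GroupHom (Young P) (Sym n)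
  inclusion P = record
    { ⟦_⟧                 = proj₁
    ; isGroupHomomorphism = record
      { isMonoidHomomorphism = record
        { isMagmaHomomorphism = record
          { isRelHomomorphism = record { cong = id }
          ; homo              = λ _ _ _ → refl
          }
        ; ε-homo = λ _ → refl
        }
      ; ⁻¹-homo = λ _ _ → refl
      }
    }

module Over (K : CommutativeRing 0ℓ 0ℓ) where

  module K = CommutativeRing K
  open K using () renaming (Carrier to ∣K∣)

  -- Negation is taken to be multiplication by -1.
  mkModule : {A : Set} {_≈_ : A → A → Set} {_+_ : A → A → A} {0# : A} {_·_ : ∣K∣ → A → A} →
    IsEquivalence _≈_ →
    (∀ {x x′ y y′} → x ≈ x′ → y ≈ y′ → (x + y) ≈ (x′ + y′)) →
    (∀ x y z → ((x + y) + z) ≈ (x + (y + z))) →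
    (∀ x y → (x + y) ≈ (y + x)) →
    (∀ x → (0# + x) ≈ x) →
    (∀ {r s x y} → r K.≈ s → x ≈ y → (r · x) ≈ (s · y)) →
    (∀ r x y → (r · (x + y)) ≈ ((r · x) + (r · y))) →
    (∀ r s x → ((r K.+ s) · x) ≈ ((r · x) + (s · x))) →
    (∀ r s x → ((r K.* s) · x) ≈ (r · (s · x))) →
    (∀ x → (K.1# · x) ≈ x) →
    (∀ x → (K.0# · x) ≈ 0#) →
    LeftModule K.ring 0ℓ 0ℓ
  mkModule {A} {_≈_} {_+_} {0#} {_·_}
    isEq +-cong +-assoc +-comm +-idˡ ·-cong ·-distribˡ ·-distribʳ ·-assoc ·-id ·-zeroˡ = record
    { Carrierᴹ = A
    ; _≈ᴹ_     = _≈_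
    ; _+ᴹ_     = _+_
    ; _*ₗ_     = _·_
    ; 0ᴹ       = 0#
    ; -ᴹ_      = (K.- K.1#) ·_
    ; isLeftModule = record
      { isLeftSemimodule = record
        { +ᴹ-isCommutativeMonoid = record
          { isMonoid = record
            { isSemigroup = record
              { isMagma = record { isEquivalence = isEq ; ∙-cong = +-cong }
              ; assoc   = +-assoc
              }
            ; identity = +-idˡ , λ x → E.trans (+-comm x 0#) (+-idˡ x)
            }
          ; comm = +-comm
          }
        ; isPreleftSemimodule = record
          { *ₗ-cong      = ·-cong
          ; *ₗ-zeroˡ     = ·-zeroˡ
          ; *ₗ-distribʳ  = λ x r s → ·-distribʳ r s x
          ; *ₗ-identityˡ = ·-id
          ; *ₗ-assoc     = ·-assoc
          ; *ₗ-zeroʳ     = λ r →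
              E.trans (·-cong K.refl (E.sym (·-zeroˡ 0#)))
              (E.trans (E.sym (·-assoc r K.0# 0#))
              (E.trans (·-cong (K.zeroʳ r) E.refl) (·-zeroˡ 0#)))
          ; *ₗ-distribˡ  = ·-distribˡ
          }
        }
      ; -ᴹ‿cong    = ·-cong K.refl
      ; -ᴹ‿inverse = invˡ , λ x → E.trans (+-comm x _) (invˡ x)
      }
    }
    where
    module E = IsEquivalence isEq
    invˡ : ∀ x → (((K.- K.1#) · x) + x) ≈ 0#
    invˡ x =
      E.trans (+-cong E.refl (E.sym (·-id x)))
      (E.trans (E.sym (·-distribʳ (K.- K.1#) K.1# x))
      (E.trans (·-cong (K.-‿inverseˡ K.1#) E.refl) (·-zeroˡ x)))

  -- A K[G]-module, given as a K-module with a K-linear action of G.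
  record Rep (G : Group 0ℓ 0ℓ) : Set₁ where
    no-eta-equality
    private module G = Group G
    field
      leftModule : LeftModule K.ring 0ℓ 0ℓ
    open LeftModule leftModule public
    infixr 7 _◁_
    field
      _◁_    : G.Carrier → Carrierᴹ → Carrierᴹ
      ◁-cong : ∀ {g h x y} → g G.≈ h → x ≈ᴹ y → (g ◁ x) ≈ᴹ (h ◁ y)
      ◁-+    : ∀ g x y → (g ◁ (x +ᴹ y)) ≈ᴹ ((g ◁ x) +ᴹ (g ◁ y))
      ◁-*ₗ   : ∀ g r x → (g ◁ (r *ₗ x)) ≈ᴹ (r *ₗ (g ◁ x))
      ◁-ε    : ∀ x → (G.ε ◁ x) ≈ᴹ x
      ◁-∙    : ∀ g h x → ((g G.∙ h) ◁ x) ≈ᴹ (g ◁ (h ◁ x))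

    IsZero : Set
    IsZero = ∀ x → x ≈ᴹ 0ᴹ

  GradedRep : Group 0ℓ 0ℓ → Set₁
  GradedRep G = ℤ → Rep G

  module _ {G : Group 0ℓ 0ℓ} where

    record Hom (M N : Rep G) : Set where
      no-eta-equality
      private
        module G = Group G
        module M = Rep M
        module N = Rep N
      field
        ⟦_⟧     : M.Carrierᴹ → N.Carrierᴹ
        ⟦⟧-cong : ∀ {x y} → x M.≈ᴹ y → ⟦ x ⟧ N.≈ᴹ ⟦ y ⟧
        ⟦⟧-+    : ∀ x y → ⟦ x M.+ᴹ y ⟧ N.≈ᴹ ⟦ x ⟧ N.+ᴹ ⟦ y ⟧
        ⟦⟧-*ₗ   : ∀ r x → ⟦ r M.*ₗ x ⟧ N.≈ᴹ r N.*ₗ ⟦ x ⟧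
        ⟦⟧-◁    : ∀ g x → ⟦ g M.◁ x ⟧ N.≈ᴹ g N.◁ ⟦ x ⟧

      ⟦⟧-0 : ⟦ M.0ᴹ ⟧ N.≈ᴹ N.0ᴹ
      ⟦⟧-0 = N.≈ᴹ-trans (⟦⟧-cong (M.≈ᴹ-sym (M.*ₗ-zeroˡ M.0ᴹ)))
        (N.≈ᴹ-trans (⟦⟧-*ₗ K.0# M.0ᴹ) (N.*ₗ-zeroˡ ⟦ M.0ᴹ ⟧))

    infix 4 _≈ʰ_
    _≈ʰ_ : {M N : Rep G} → Hom M N → Hom M N → Set
    _≈ʰ_ {N = N} f g = ∀ x → Rep._≈ᴹ_ N (Hom.⟦_⟧ f x) (Hom.⟦_⟧ g x)

    idʰ : {M : Rep G} → Hom M M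
    idʰ {M} = record
      { ⟦_⟧     = id
      ; ⟦⟧-cong = id
      ; ⟦⟧-+    = λ _ _ → ≈ᴹ-refl
      ; ⟦⟧-*ₗ   = λ _ _ → ≈ᴹ-refl
      ; ⟦⟧-◁    = λ _ _ → ≈ᴹ-refl
      } where open Rep M

    infixr 9 _∘ʰ_
    _∘ʰ_ : {L M N : Rep G} → Hom M N → Hom L M → Hom L N
    _∘ʰ_ {N = N} f g = record
      { ⟦_⟧     = f.⟦_⟧ ∘ g.⟦_⟧
      ; ⟦⟧-cong = f.⟦⟧-cong ∘ g.⟦⟧-cong
      ; ⟦⟧-+    = λ x y → ≈ᴹ-trans (f.⟦⟧-cong (g.⟦⟧-+ x y)) (f.⟦⟧-+ g.⟦ x ⟧ g.⟦ y ⟧)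
      ; ⟦⟧-*ₗ   = λ r x → ≈ᴹ-trans (f.⟦⟧-cong (g.⟦⟧-*ₗ r x)) (f.⟦⟧-*ₗ r g.⟦ x ⟧)
      ; ⟦⟧-◁    = λ h x → ≈ᴹ-trans (f.⟦⟧-cong (g.⟦⟧-◁ h x)) (f.⟦⟧-◁ h g.⟦ x ⟧)
      }
      where
      open Rep N
      module f = Hom f
      module g = Hom g

    module _ {M N : Rep G} where
      private module M = Rep M
      open Rep N
      open Sum +ᴹ-commutativeMonoid using (sum; sum-cong-≋; sum-replicate-zero; ∑-distrib-+)

      0ʰ : Hom M N
      0ʰ = record
        { ⟦_⟧     = λ _ → 0ᴹ
        ; ⟦⟧-cong = λ _ → ≈ᴹ-refl
        ; ⟦⟧-+    = λ _ _ → ≈ᴹ-sym (+ᴹ-identityˡ 0ᴹ)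
        ; ⟦⟧-*ₗ   = λ r _ → ≈ᴹ-sym (*ₗ-zeroʳ r)
        ; ⟦⟧-◁    = λ g _ → ≈ᴹ-sym (◁-0 g)
        }
        where
        ◁-0 : ∀ g → (g ◁ 0ᴹ) ≈ᴹ 0ᴹ
        ◁-0 g = ≈ᴹ-trans (◁-cong (Group.refl G) (≈ᴹ-sym (*ₗ-zeroˡ 0ᴹ)))
          (≈ᴹ-trans (◁-*ₗ g K.0# 0ᴹ) (*ₗ-zeroˡ (g ◁ 0ᴹ)))

      infixl 6 _+ʰ_
      _+ʰ_ : Hom M N → Hom M N → Hom M N
      f +ʰ g = record
        { ⟦_⟧     = λ x → f.⟦ x ⟧ +ᴹ g.⟦ x ⟧
        ; ⟦⟧-cong = λ p → +ᴹ-cong (f.⟦⟧-cong p) (g.⟦⟧-cong p)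
        ; ⟦⟧-+    = λ x y → ≈ᴹ-trans (+ᴹ-cong (f.⟦⟧-+ x y) (g.⟦⟧-+ x y))
                              (interchange f.⟦ x ⟧ f.⟦ y ⟧ g.⟦ x ⟧ g.⟦ y ⟧)
        ; ⟦⟧-*ₗ   = λ r x → ≈ᴹ-trans (+ᴹ-cong (f.⟦⟧-*ₗ r x) (g.⟦⟧-*ₗ r x))
                              (≈ᴹ-sym (*ₗ-distribˡ r f.⟦ x ⟧ g.⟦ x ⟧))
        ; ⟦⟧-◁    = λ h x → ≈ᴹ-trans (+ᴹ-cong (f.⟦⟧-◁ h x) (g.⟦⟧-◁ h x))
                              (≈ᴹ-sym (◁-+ h f.⟦ x ⟧ g.⟦ x ⟧))
        }
        where
        module f = Hom f
        module g = Hom g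
        open import Algebra.Properties.CommutativeSemigroup
          (CommutativeMonoid.commutativeSemigroup +ᴹ-commutativeMonoid)
          using (interchange)

      infixr 7 _·ʰ_
      _·ʰ_ : ∣K∣ → Hom M N → Hom M N
      r ·ʰ f = record
        { ⟦_⟧     = λ x → r *ₗ f.⟦ x ⟧
        ; ⟦⟧-cong = λ p → *ₗ-congˡ (f.⟦⟧-cong p)
        ; ⟦⟧-+    = λ x y → ≈ᴹ-trans (*ₗ-congˡ (f.⟦⟧-+ x y)) (*ₗ-distribˡ r f.⟦ x ⟧ f.⟦ y ⟧)
        ; ⟦⟧-*ₗ   = λ s x → ≈ᴹ-trans (*ₗ-congˡ (f.⟦⟧-*ₗ s x))
            (≈ᴹ-trans (≈ᴹ-sym (*ₗ-assoc r s f.⟦ x ⟧))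
            (≈ᴹ-trans (*ₗ-congʳ (K.*-comm r s)) (*ₗ-assoc s r f.⟦ x ⟧)))
        ; ⟦⟧-◁    = λ h x → ≈ᴹ-trans (*ₗ-congˡ (f.⟦⟧-◁ h x)) (≈ᴹ-sym (◁-*ₗ h r f.⟦ x ⟧))
        }
        where module f = Hom f

      ∑ʰ : ∀ {k} → (Fin k → Hom M N) → Hom M N
      ∑ʰ {zero}  f = 0ʰ
      ∑ʰ {suc k} f = f zero +ʰ ∑ʰ (f ∘ suc)

    zeroRep : Rep G
    zeroRep = record
      { leftModule = Zero.leftModule
      ; _◁_    = λ _ _ → tt
      ; ◁-cong = λ _ _ → tt
      ; ◁-+    = λ _ _ _ → tt
      ; ◁-*ₗ   = λ _ _ _ → tt
      ; ◁-ε    = λ _ → tt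
      ; ◁-∙    = λ _ _ _ → tt
      }

    trivial : Rep G
    trivial = record
      { leftModule = TensorUnit.leftModule
      ; _◁_    = λ _ r → r
      ; ◁-cong = λ _ p → p
      ; ◁-+    = λ _ _ _ → K.refl
      ; ◁-*ₗ   = λ _ _ _ → K.refl
      ; ◁-ε    = λ _ → K.refl
      ; ◁-∙    = λ _ _ _ → K.refl
      }

    ∏ : (I : Set) → (I → Rep G) → Rep G
    ∏ I M = record
      { leftModule = mkModule
          {A = ∀ i → M.Carrierᴹ i}
          {_≈_ = λ x y → ∀ i → M._≈ᴹ_ i (x i) (y i)}
          {_+_ = λ x y i → M._+ᴹ_ i (x i) (y i)}
          {0# = M.0ᴹ}
          {_·_ = λ r x i → M._*ₗ_ i r (x i)}
          (record { refl  = λ i → M.≈ᴹ-refl i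
                  ; sym   = λ p i → M.≈ᴹ-sym i (p i)
                  ; trans = λ p q i → M.≈ᴹ-trans i (p i) (q i) })
          (λ p q i → M.+ᴹ-cong i (p i) (q i))
          (λ x y z i → M.+ᴹ-assoc i (x i) (y i) (z i))
          (λ x y i → M.+ᴹ-comm i (x i) (y i))
          (λ x i → M.+ᴹ-identityˡ i (x i))
          (λ p q i → M.*ₗ-cong i p (q i))
          (λ r x y i → M.*ₗ-distribˡ i r (x i) (y i))
          (λ r s x i → M.*ₗ-distribʳ i (x i) r s)
          (λ r s x i → M.*ₗ-assoc i r s (x i))
          (λ x i → M.*ₗ-identityˡ i (x i))
          (λ x i → M.*ₗ-zeroˡ i (x i))
      ; _◁_    = λ g x i → M._◁_ i g (x i)
      ; ◁-cong = λ p q i → M.◁-cong i p (q i)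
      ; ◁-+    = λ g x y i → M.◁-+ i g (x i) (y i)
      ; ◁-*ₗ   = λ g r x i → M.◁-*ₗ i g r (x i)
      ; ◁-ε    = λ x i → M.◁-ε i (x i)
      ; ◁-∙    = λ g h x i → M.◁-∙ i g h (x i)
      }
      where module M i = Rep (M i)

    π : {I : Set} {M : I → Rep G} (i : I) → Hom (∏ I M) (M i)
    π {M = M} i = record
      { ⟦_⟧     = λ x → x i
      ; ⟦⟧-cong = λ p → p i
      ; ⟦⟧-+    = λ _ _ → ≈ᴹ-refl
      ; ⟦⟧-*ₗ   = λ _ _ → ≈ᴹ-refl
      ; ⟦⟧-◁    = λ _ _ → ≈ᴹ-refl
      } where open Rep (M i)

    tuple : {I : Set} {L : Rep G} {M : I → Rep G} → (∀ i → Hom L (M i)) → Hom L (∏ I M)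
    tuple f = record
      { ⟦_⟧     = λ x i → Hom.⟦_⟧ (f i) x
      ; ⟦⟧-cong = λ p i → Hom.⟦⟧-cong (f i) p
      ; ⟦⟧-+    = λ x y i → Hom.⟦⟧-+ (f i) x y
      ; ⟦⟧-*ₗ   = λ r x i → Hom.⟦⟧-*ₗ (f i) r x
      ; ⟦⟧-◁    = λ g x i → Hom.⟦⟧-◁ (f i) g x
      }

    -- ker g / im f, for g ∘ f = 0: cocycles are equal when they differ by some f a.
    Homology : {A B C : Rep G} → Hom A B → Hom B C → Rep G
    Homology {A} {B} {C} f g = record
      { leftModule = mkModule
          {A = Σ[ x ∈ Carrierᴹ ] g.⟦ x ⟧ C.≈ᴹ C.0ᴹ}
          {_≈_ = λ x y → ∃[ a ] proj₁ x ≈ᴹ proj₁ y +ᴹ f.⟦ a ⟧}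
          {_+_ = λ (x , p) (y , q) → x +ᴹ y ,
             C.≈ᴹ-trans (g.⟦⟧-+ x y) (C.≈ᴹ-trans (C.+ᴹ-cong p q) (C.+ᴹ-identityˡ C.0ᴹ))}
          {0# = 0ᴹ , g.⟦⟧-0}
          {_·_ = λ r (x , p) → r *ₗ x ,
             C.≈ᴹ-trans (g.⟦⟧-*ₗ r x) (C.≈ᴹ-trans (C.*ₗ-congˡ p) (C.*ₗ-zeroʳ r))}
          (record
            { refl  = λ {x} → emb ≈ᴹ-refl
            ; sym   = λ {x} {y} (a , p) → K.- K.1# A.*ₗ a ,
                ≈ᴹ-sym (≈ᴹ-trans (+ᴹ-cong p (f.⟦⟧-*ₗ (K.- K.1#) a))
                (≈ᴹ-trans (+ᴹ-assoc _ _ _)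
                (≈ᴹ-trans (+ᴹ-congˡ (cancel f.⟦ a ⟧)) (+ᴹ-identityʳ _))))
            ; trans = λ {x} {y} {z} (a , p) (b , q) → b A.+ᴹ a ,
                ≈ᴹ-trans p (≈ᴹ-trans (+ᴹ-congʳ q) (≈ᴹ-trans (+ᴹ-assoc _ _ _)
                  (+ᴹ-congˡ (≈ᴹ-sym (f.⟦⟧-+ b a)))))
            })
          (λ {x} {x′} {y} {y′} (a , p) (b , q) → a A.+ᴹ b ,
            ≈ᴹ-trans (+ᴹ-cong p q)
              (≈ᴹ-trans (interchange _ _ _ _) (+ᴹ-congˡ (≈ᴹ-sym (f.⟦⟧-+ a b)))))
          (λ x y z → emb (+ᴹ-assoc _ _ _))
          (λ x y → emb (+ᴹ-comm _ _))
          (λ x → emb (+ᴹ-identityˡ _))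
          (λ {r} {s} {x} {y} r≈s (a , p) → s A.*ₗ a ,
            ≈ᴹ-trans (*ₗ-cong r≈s p)
              (≈ᴹ-trans (*ₗ-distribˡ s _ _) (+ᴹ-congˡ (≈ᴹ-sym (f.⟦⟧-*ₗ s a)))))
          (λ r x y → emb (*ₗ-distribˡ r _ _))
          (λ r s x → emb (*ₗ-distribʳ _ r s))
          (λ r s x → emb (*ₗ-assoc r s _))
          (λ x → emb (*ₗ-identityˡ _))
          (λ x → emb (*ₗ-zeroˡ _))
      ; _◁_    = λ h (x , p) → h ◁ x ,
          C.≈ᴹ-trans (g.⟦⟧-◁ h x) (C.≈ᴹ-trans (C.◁-cong (Group.refl G) p)
            (C.≈ᴹ-trans (C.◁-cong (Group.refl G) (C.≈ᴹ-sym (C.*ₗ-zeroˡ C.0ᴹ)))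
            (C.≈ᴹ-trans (C.◁-*ₗ h K.0# C.0ᴹ) (C.*ₗ-zeroˡ _))))
      ; ◁-cong = λ {h} {k} h≈k (a , p) → k A.◁ a ,
          ≈ᴹ-trans (◁-cong h≈k p)
            (≈ᴹ-trans (◁-+ k _ _) (+ᴹ-congˡ (≈ᴹ-sym (f.⟦⟧-◁ k a))))
      ; ◁-+    = λ h x y → emb (◁-+ h _ _)
      ; ◁-*ₗ   = λ h r x → emb (◁-*ₗ h r _)
      ; ◁-ε    = λ x → emb (◁-ε _)
      ; ◁-∙    = λ h k x → emb (◁-∙ h k _)
      }
      where
      open Rep B
      module A = Rep A
      module C = Rep C
      module f = Hom f
      module g = Hom g
      open import Algebra.Properties.CommutativeSemigroup
        (CommutativeMonoid.commutativeSemigroup +ᴹ-commutativeMonoid)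
        using (interchange)

      emb : ∀ {x y} → x ≈ᴹ y → ∃[ a ] x ≈ᴹ y +ᴹ f.⟦ a ⟧
      emb p = A.0ᴹ , ≈ᴹ-trans p
        (≈ᴹ-trans (≈ᴹ-sym (+ᴹ-identityʳ _)) (+ᴹ-congˡ (≈ᴹ-sym f.⟦⟧-0)))

      cancel : ∀ x → x +ᴹ (K.- K.1#) *ₗ x ≈ᴹ 0ᴹ
      cancel x = ≈ᴹ-trans (+ᴹ-congʳ (≈ᴹ-sym (*ₗ-identityˡ x)))
        (≈ᴹ-trans (≈ᴹ-sym (*ₗ-distribʳ x K.1# (K.- K.1#)))
        (≈ᴹ-trans (*ₗ-congʳ (K.-‿inverseʳ K.1#)) (*ₗ-zeroˡ x)))

  Res : {H G : Group 0ℓ 0ℓ} → GroupHom H G → Rep G → Rep H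
  Res {H} {G} φ M = record
    { leftModule = M.leftModule
    ; _◁_    = λ h x → φ.⟦ h ⟧ M.◁ x
    ; ◁-cong = λ p q → M.◁-cong (φ.⟦⟧-cong p) q
    ; ◁-+    = λ h → M.◁-+ φ.⟦ h ⟧
    ; ◁-*ₗ   = λ h → M.◁-*ₗ φ.⟦ h ⟧
    ; ◁-ε    = λ x → M.≈ᴹ-trans (M.◁-cong φ.ε-homo M.≈ᴹ-refl) (M.◁-ε x)
    ; ◁-∙    = λ h k x → M.≈ᴹ-trans (M.◁-cong (φ.homo h k) M.≈ᴹ-refl)
                           (M.◁-∙ φ.⟦ h ⟧ φ.⟦ k ⟧ x)
    }
    where
    module M = Rep M
    module φ = GroupHom φ

  infixl 6 _⊕_
  infixr 7 _⊙_
  data Term (X : Set) : Set where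
    gen : X → Term X
    𝟘   : Term X
    _⊕_ : Term X → Term X → Term X
    _⊙_ : ∣K∣ → Term X → Term X

  mapTerm : {X Y : Set} → (X → Y) → Term X → Term Y
  mapTerm f (gen x) = gen (f x)
  mapTerm f 𝟘       = 𝟘
  mapTerm f (s ⊕ t) = mapTerm f s ⊕ mapTerm f t
  mapTerm f (r ⊙ t) = r ⊙ mapTerm f t

  -- The least K-module congruence on Term X containing R.
  data Cong {X : Set} (R : Term X → Term X → Set) : Term X → Term X → Set where
    rel        : ∀ {s t} → R s t → Cong R s t
    ≈-refl     : ∀ {t} → Cong R t t
    ≈-sym      : ∀ {s t} → Cong R s t → Cong R t s
    ≈-trans    : ∀ {s t u} → Cong R s t → Cong R t u → Cong R s u
    ⊕-cong     : ∀ {s s′ t t′} → Cong R s s′ → Cong R t t′ → Cong R (s ⊕ t) (s′ ⊕ t′)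
    ⊕-assoc    : ∀ s t u → Cong R ((s ⊕ t) ⊕ u) (s ⊕ (t ⊕ u))
    ⊕-comm     : ∀ s t → Cong R (s ⊕ t) (t ⊕ s)
    ⊕-identity : ∀ t → Cong R (𝟘 ⊕ t) t
    ⊙-cong     : ∀ {r r′ t t′} → r K.≈ r′ → Cong R t t′ → Cong R (r ⊙ t) (r′ ⊙ t′)
    ⊙-distribˡ : ∀ r s t → Cong R (r ⊙ (s ⊕ t)) (r ⊙ s ⊕ r ⊙ t)
    ⊙-distribʳ : ∀ r s t → Cong R ((r K.+ s) ⊙ t) (r ⊙ t ⊕ s ⊙ t)
    ⊙-assoc    : ∀ r s t → Cong R ((r K.* s) ⊙ t) (r ⊙ (s ⊙ t))
    ⊙-identity : ∀ t → Cong R (K.1# ⊙ t) t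
    ⊙-zero     : ∀ t → Cong R (K.0# ⊙ t) 𝟘

  presented : {X : Set} → (Term X → Term X → Set) → LeftModule K.ring 0ℓ 0ℓ
  presented R = mkModule {_≈_ = Cong R}
    (record { refl = ≈-refl ; sym = ≈-sym ; trans = ≈-trans })
    ⊕-cong ⊕-assoc ⊕-comm ⊕-identity ⊙-cong ⊙-distribˡ ⊙-distribʳ ⊙-assoc ⊙-identity ⊙-zero

  -- The G-action on the module presented by X and R which permutes the
  -- generators as prescribed by act.
  presentedRep : {G : Group 0ℓ 0ℓ} {X : Set} (R : Term X → Term X → Set)
    (act : Group.Carrier G → X → X) →
    (∀ g {s t} → R s t → Cong R (mapTerm (act g) s) (mapTerm (act g) t)) →
    (∀ {g h} → Group._≈_ G g h → ∀ x → Cong R (gen (act g x)) (gen (act h x))) →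
    (∀ x → Cong R (gen (act (Group.ε G) x)) (gen x)) →
    (∀ g h x → Cong R (gen (act (Group._∙_ G g h) x)) (gen (act g (act h x)))) →
    Rep G
  presentedRep {G} {X} R act act-R act-≈ act-ε act-∙ = record
    { leftModule = presented R
    ; _◁_    = λ g → mapTerm (act g)
    ; ◁-cong = λ {g} {h} g≈h p → ≈-trans (map-cong g p) (map-≈ g≈h _)
    ; ◁-+    = λ _ _ _ → ≈-refl
    ; ◁-*ₗ   = λ _ _ _ → ≈-refl
    ; ◁-ε    = map-ε
    ; ◁-∙    = map-∙
    }
    where
    open Group G using (Carrier; _∙_) renaming (_≈_ to _≈ᴳ_; ε to 1ᴳ)

    map-cong : ∀ g {s t} → Cong R s t → Cong R (mapTerm (act g) s) (mapTerm (act g) t)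
    map-cong g (rel p)            = act-R g p
    map-cong g ≈-refl             = ≈-refl
    map-cong g (≈-sym p)          = ≈-sym (map-cong g p)
    map-cong g (≈-trans p q)      = ≈-trans (map-cong g p) (map-cong g q)
    map-cong g (⊕-cong p q)       = ⊕-cong (map-cong g p) (map-cong g q)
    map-cong g (⊕-assoc s t u)    = ⊕-assoc _ _ _
    map-cong g (⊕-comm s t)       = ⊕-comm _ _
    map-cong g (⊕-identity t)     = ⊕-identity _
    map-cong g (⊙-cong p q)       = ⊙-cong p (map-cong g q)
    map-cong g (⊙-distribˡ r s t) = ⊙-distribˡ _ _ _
    map-cong g (⊙-distribʳ r s t) = ⊙-distribʳ _ _ _
    map-cong g (⊙-assoc r s t)    = ⊙-assoc _ _ _
    map-cong g (⊙-identity t)     = ⊙-identity _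
    map-cong g (⊙-zero t)         = ⊙-zero _

    map-≈ : ∀ {g h} → g ≈ᴳ h → ∀ t → Cong R (mapTerm (act g) t) (mapTerm (act h) t)
    map-≈ p (gen x) = act-≈ p x
    map-≈ p 𝟘       = ≈-refl
    map-≈ p (s ⊕ t) = ⊕-cong (map-≈ p s) (map-≈ p t)
    map-≈ p (r ⊙ t) = ⊙-cong K.refl (map-≈ p t)

    map-ε : ∀ t → Cong R (mapTerm (act 1ᴳ) t) t
    map-ε (gen x) = act-ε x
    map-ε 𝟘       = ≈-refl
    map-ε (s ⊕ t) = ⊕-cong (map-ε s) (map-ε t)
    map-ε (r ⊙ t) = ⊙-cong K.refl (map-ε t)

    map-∙ : ∀ g h t → Cong R (mapTerm (act (g ∙ h)) t) (mapTerm (act g) (mapTerm (act h) t))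
    map-∙ g h (gen x) = act-∙ g h x
    map-∙ g h 𝟘       = ≈-refl
    map-∙ g h (s ⊕ t) = ⊕-cong (map-∙ g h s) (map-∙ g h t)
    map-∙ g h (r ⊙ t) = ⊙-cong K.refl (map-∙ g h t)

  module _ {G : Group 0ℓ 0ℓ} (V : Rep G) (k : ℕ) where
    open Rep V
    private module G = Group G

    -- gen (v₁ ∷ ⋯ ∷ vₖ ∷ []) stands for v₁ ∧ ⋯ ∧ vₖ.
    data ⋀-Relation : Term (Vec Carrierᴹ k) → Term (Vec Carrierᴹ k) → Set where
      congruent   : ∀ {vs ws} → Pointwise _≈ᴹ_ vs ws → ⋀-Relation (gen vs) (gen ws)
      additive    : ∀ vs i x y → ⋀-Relation
                      (gen (vs [ i ]≔ (x +ᴹ y))) (gen (vs [ i ]≔ x) ⊕ gen (vs [ i ]≔ y))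
      homogeneous : ∀ vs i r x → ⋀-Relation (gen (vs [ i ]≔ (r *ₗ x))) (r ⊙ gen (vs [ i ]≔ x))
      alternating : ∀ {vs i j} → i ≢ j → lookup vs i ≈ᴹ lookup vs j → ⋀-Relation (gen vs) 𝟘

    ⋀ : Rep G
    ⋀ = presentedRep ⋀-Relation (λ g → Vec.map (g ◁_)) respects
      (λ g≈h vs → rel (congruent (pw (λ v → ◁-cong g≈h ≈ᴹ-refl) vs)))
      (λ vs → rel (congruent (subst (Pointwise _≈ᴹ_ (Vec.map (G.ε ◁_) vs)) (Vec.map-id vs) (pw ◁-ε vs))))
      (λ g h vs → rel (congruent
        (subst (Pointwise _≈ᴹ_ (Vec.map ((g G.∙ h) ◁_) vs)) (Vec.map-∘ (g ◁_) (h ◁_) vs)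
          (pw (◁-∙ g h) vs))))
      where
      pw : ∀ {l} {f f′ : Carrierᴹ → Carrierᴹ} → (∀ v → f v ≈ᴹ f′ v) →
           (vs : Vec Carrierᴹ l) → Pointwise _≈ᴹ_ (Vec.map f vs) (Vec.map f′ vs)
      pw p []       = []
      pw p (v ∷ vs) = p v ∷ pw p vs

      pw-≔ : ∀ {l x y} (vs : Vec Carrierᴹ l) i → x ≈ᴹ y →
             Pointwise _≈ᴹ_ (vs [ i ]≔ x) (vs [ i ]≔ y)
      pw-≔ (v ∷ vs) zero    p = p ∷ Pointwise.refl ≈ᴹ-refl
      pw-≔ (v ∷ vs) (suc i) p = ≈ᴹ-refl ∷ pw-≔ vs i p

      respects : ∀ g {s t} → ⋀-Relation s t →
        Cong ⋀-Relation (mapTerm (Vec.map (g ◁_)) s) (mapTerm (Vec.map (g ◁_)) t)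
      respects g (congruent p) = rel (congruent (pmap p))
        where
        pmap : ∀ {l} {vs ws : Vec Carrierᴹ l} → Pointwise _≈ᴹ_ vs ws →
               Pointwise _≈ᴹ_ (Vec.map (g ◁_) vs) (Vec.map (g ◁_) ws)
        pmap []       = []
        pmap (p ∷ ps) = ◁-cong G.refl p ∷ pmap ps
      respects g (additive vs i x y)
        rewrite Vec.map-[]≔ {x = x +ᴹ y} (g ◁_) vs i
              | Vec.map-[]≔ {x = x} (g ◁_) vs i
              | Vec.map-[]≔ {x = y} (g ◁_) vs i
        = ≈-trans (rel (congruent (pw-≔ (Vec.map (g ◁_) vs) i (◁-+ g x y))))
            (rel (additive (Vec.map (g ◁_) vs) i (g ◁ x) (g ◁ y)))
      respects g (homogeneous vs i r x)
        rewrite Vec.map-[]≔ {x = r *ₗ x} (g ◁_) vs i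
              | Vec.map-[]≔ {x = x} (g ◁_) vs i
        = ≈-trans (rel (congruent (pw-≔ (Vec.map (g ◁_) vs) i (◁-*ₗ g r x))))
            (rel (homogeneous (Vec.map (g ◁_) vs) i r (g ◁ x)))
      respects g (alternating {vs} {i} {j} i≢j p) = rel (alternating i≢j
        (subst₂ _≈ᴹ_ (sym (Vec.lookup-map i (g ◁_) vs)) (sym (Vec.lookup-map j (g ◁_) vs))
          (◁-cong G.refl p)))

  ⋀* : {G : Group 0ℓ 0ℓ} → Rep G → GradedRep G
  ⋀* V (+ k)    = ⋀ V k
  ⋀* V -[1+ _ ] = zeroRep

  unit : {G : Group 0ℓ 0ℓ} → GradedRep G
  unit (+ zero)  = trivial
  unit (+ suc _) = zeroRep
  unit -[1+ _ ]  = zeroRep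

  module _ {G : Group 0ℓ 0ℓ} (A B : GradedRep G) (j : ℤ) where
    private
      module G = Group G
      module A p = Rep (A p)
      module B q = Rep (B q)

    record PureTensor : Set where
      constructor pure
      field
        p q   : ℤ
        p+q≡j : p ℤ.+ q ≡ j
        left  : A.Carrierᴹ p
        right : B.Carrierᴹ q

    -- The degree j part of A ⊗ B is the sum of A_p ⊗ B_q over p + q = j.
    data ⊗-Relation : Term PureTensor → Term PureTensor → Set where
      congruent    : ∀ {p q e a a′ b b′} → A._≈ᴹ_ p a a′ → B._≈ᴹ_ q b b′ →
                     ⊗-Relation (gen (pure p q e a b)) (gen (pure p q e a′ b′))
      additiveˡ    : ∀ {p q e} a a′ b → ⊗-Relation
                     (gen (pure p q e (A._+ᴹ_ p a a′) b))
                     (gen (pure p q e a b) ⊕ gen (pure p q e a′ b))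
      additiveʳ    : ∀ {p q e} a b b′ → ⊗-Relation
                     (gen (pure p q e a (B._+ᴹ_ q b b′)))
                     (gen (pure p q e a b) ⊕ gen (pure p q e a b′))
      homogeneousˡ : ∀ {p q e} r a b → ⊗-Relation
                     (gen (pure p q e (A._*ₗ_ p r a) b)) (r ⊙ gen (pure p q e a b))
      homogeneousʳ : ∀ {p q e} r a b → ⊗-Relation
                     (gen (pure p q e a (B._*ₗ_ q r b))) (r ⊙ gen (pure p q e a b))

    ⊗-degree : Rep G
    ⊗-degree = presentedRep ⊗-Relation act respects
      (λ { g≈h (pure p q _ _ _) → rel (congruent (A.◁-cong p g≈h (A.≈ᴹ-refl p))
                                                 (B.◁-cong q g≈h (B.≈ᴹ-refl q))) })
      (λ { (pure p q _ a b) → rel (congruent (A.◁-ε p a) (B.◁-ε q b)) })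
      (λ { g h (pure p q _ a b) → rel (congruent (A.◁-∙ p g h a) (B.◁-∙ q g h b)) })
      where
      act : G.Carrier → PureTensor → PureTensor
      act g (pure p q e a b) = pure p q e (A._◁_ p g a) (B._◁_ q g b)

      respects : ∀ g {s t} → ⊗-Relation s t →
                 Cong ⊗-Relation (mapTerm (act g) s) (mapTerm (act g) t)
      respects g (congruent {p} {q} x y) =
        rel (congruent (A.◁-cong p G.refl x) (B.◁-cong q G.refl y))
      respects g (additiveˡ {p} {q} a a′ b) =
        ≈-trans (rel (congruent (A.◁-+ p g a a′) (B.≈ᴹ-refl q))) (rel (additiveˡ _ _ _))
      respects g (additiveʳ {p} {q} a b b′) =
        ≈-trans (rel (congruent (A.≈ᴹ-refl p) (B.◁-+ q g b b′))) (rel (additiveʳ _ _ _))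
      respects g (homogeneousˡ {p} {q} r a b) =
        ≈-trans (rel (congruent (A.◁-*ₗ p g r a) (B.≈ᴹ-refl q))) (rel (homogeneousˡ _ _ _))
      respects g (homogeneousʳ {p} {q} r a b) =
        ≈-trans (rel (congruent (A.≈ᴹ-refl p) (B.◁-*ₗ q g r b))) (rel (homogeneousʳ _ _ _))

  infixr 6 _⊗_
  _⊗_ : {G : Group 0ℓ 0ℓ} → GradedRep G → GradedRep G → GradedRep G
  A ⊗ B = ⊗-degree A B

  module _ {H G : Group 0ℓ 0ℓ} (φ : GroupHom H G) (W : Rep H) where
    private
      module G = Group G
      module H = Group H
      module W = Rep W
      module φ = GroupHom φ

    -- K[G] ⊗_{K[H]} W, where gen (g , w) stands for g ⊗ w.
    data Ind-Relation : Term (G.Carrier × W.Carrierᴹ) → Term (G.Carrier × W.Carrierᴹ) → Set where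
      congruent   : ∀ {g g′ w w′} → g G.≈ g′ → w W.≈ᴹ w′ →
                    Ind-Relation (gen (g , w)) (gen (g′ , w′))
      additive    : ∀ g w w′ → Ind-Relation (gen (g , w W.+ᴹ w′)) (gen (g , w) ⊕ gen (g , w′))
      homogeneous : ∀ g r w → Ind-Relation (gen (g , r W.*ₗ w)) (r ⊙ gen (g , w))
      balanced    : ∀ g h w → Ind-Relation (gen (g G.∙ φ.⟦ h ⟧ , w)) (gen (g , h W.◁ w))

    Ind : Rep G
    Ind = presentedRep Ind-Relation (λ k (g , w) → k G.∙ g , w) respects
      (λ k≈l (g , w) → rel (congruent (G.∙-congʳ k≈l) W.≈ᴹ-refl))
      (λ (g , w) → rel (congruent (G.identityˡ g) W.≈ᴹ-refl))
      (λ k l (g , w) → rel (congruent (G.assoc k l g) W.≈ᴹ-refl))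
      where
      respects : ∀ k {s t} → Ind-Relation s t →
        Cong Ind-Relation (mapTerm (λ (g , w) → k G.∙ g , w) s) (mapTerm (λ (g , w) → k G.∙ g , w) t)
      respects k (congruent p q)     = rel (congruent (G.∙-congˡ p) q)
      respects k (additive g w w′)   = rel (additive _ _ _)
      respects k (homogeneous g r w) = rel (homogeneous _ _ _)
      respects k (balanced g h w)    =
        ≈-trans (rel (congruent (G.sym (G.assoc k g φ.⟦ h ⟧)) W.≈ᴹ-refl)) (rel (balanced _ _ _))

  module _ {n : ℕ} where
    open Sum K.+-commutativeMonoid using (sum; sum-permute; sum-cong-≋; ∑-distrib-+; sum-replicate-zero)
    open import Algebra.Properties.Semiring.Sum K.semiring using (*-distribˡ-sum)

    -- S^(b-1,1) for b = |B|: the vectors in K^B with coordinate sum 0, where K^B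
    -- consists of the vectors in K^n supported on B, and (σv)(x) = v(σ⁻¹x).
    record StandardVector (B : Subset n) : Set where
      field
        at         : Fin n → ∣K∣
        supported  : ∀ x → x ∉ B → at x K.≈ K.0#
        sum≈0      : sum at K.≈ K.0#

    open StandardVector

    S⟨b-1,1⟩ : (B : Subset n) → Rep (Young (B ∷ []))
    S⟨b-1,1⟩ B = record
      { leftModule = mkModule
          {A = StandardVector B}
          {_≈_ = λ v w → ∀ x → at v x K.≈ at w x}
          {_+_ = λ v w → record
            { at        = λ x → at v x K.+ at w x
            ; supported = λ x x∉B → K.trans (K.+-cong (supported v x x∉B) (supported w x x∉B))
                                            (K.+-identityˡ K.0#)
            ; sum≈0     = K.trans (∑-distrib-+ (at v) (at w))
                (K.trans (K.+-cong (sum≈0 v) (sum≈0 w)) (K.+-identityˡ K.0#))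
            }}
          {0# = record
            { at        = λ _ → K.0#
            ; supported = λ _ _ → K.refl
            ; sum≈0     = sum-replicate-zero n
            }}
          {_·_ = λ r v → record
            { at        = λ x → r K.* at v x
            ; supported = λ x x∉B → K.trans (K.*-congˡ (supported v x x∉B)) (K.zeroʳ r)
            ; sum≈0     = K.trans (K.sym (*-distribˡ-sum r (at v)))
                (K.trans (K.*-congˡ (sum≈0 v)) (K.zeroʳ r))
            }}
          (record { refl  = λ _ → K.refl
                  ; sym   = λ p x → K.sym (p x)
                  ; trans = λ p q x → K.trans (p x) (q x) })
          (λ p q x → K.+-cong (p x) (q x))
          (λ u v w x → K.+-assoc (at u x) (at v x) (at w x))
          (λ u v x → K.+-comm (at u x) (at v x))
          (λ u x → K.+-identityˡ (at u x))
          (λ p q x → K.*-cong p (q x))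
          (λ r u v x → K.distribˡ r (at u x) (at v x))
          (λ r s v x → K.distribʳ (at v x) r s)
          (λ r s v x → K.*-assoc r s (at v x))
          (λ v x → K.*-identityˡ (at v x))
          (λ v x → K.zeroˡ (at v x))
      ; _◁_    = λ { (σ , pres ∷ []) v → record
          { at        = λ x → at v (σ ⟨$⟩ˡ x)
          ; supported = λ x x∉B → supported v (σ ⟨$⟩ˡ x) λ y∈B →
              x∉B (subst (_∈ B) (Perm.inverseʳ σ) (Equivalence.to (pres (σ ⟨$⟩ˡ x)) y∈B))
          ; sum≈0     = K.trans (K.sym (sum-permute (at v) (Perm.flip σ))) (sum≈0 v)
          } }
      ; ◁-cong = λ { {σ , _ ∷ []} {τ , _ ∷ []} {v} {w} σ≈τ p x →
          K.trans (p (σ ⟨$⟩ˡ x))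
            (K.reflexive (cong (at w) (S.⁻¹-cong {σ} {τ} σ≈τ x))) }
      ; ◁-+    = λ { (_ , _ ∷ []) _ _ _ → K.refl }
      ; ◁-*ₗ   = λ { (_ , _ ∷ []) _ _ _ → K.refl }
      ; ◁-ε    = λ _ _ → K.refl
      ; ◁-∙    = λ { (_ , _ ∷ []) (_ , _ ∷ []) _ _ → K.refl }
      }
      where module S = Group (Sym n)

    𝓛 : (B : Subset n) → GradedRep (Young (B ∷ []))
    𝓛 B = ⋀* (S⟨b-1,1⟩ B)

    ⨂𝓛 : (P : List (Subset n)) → GradedRep (Young P)
    ⨂𝓛 []      = unit
    ⨂𝓛 (B ∷ P) = (Res restrictHead ∘ 𝓛 B) ⊗ (Res restrictTail ∘ ⨂𝓛 P)

    𝓜 : List (Subset n) → GradedRep (Sym n)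
    𝓜 P j = Ind (inclusion P) (⨂𝓛 P j)

    -- The identity map of 𝓜 P, viewed as a map to 𝓜 Q.
    𝓜-≡ : ∀ {P Q} → P ≡ Q → ∀ j → Hom (𝓜 P j) (𝓜 Q j)
    𝓜-≡ refl j = idʰ

  -- A functor from the poset of edge sets, with T ↦ 𝓜_T, to graded representations of
  -- Sₙ. Its value is unconstrained where the added edge joins two components. The
  -- laws quantify over all inclusion proofs, so F₁ depends only on T and T′.
  record ChromaticSymmetricFunctor {n : ℕ} (G : Graph n) : Set where
    open Graph G
    field
      F₁       : ∀ {T T′} → T ⊆ T′ → ∀ j → Hom (𝓜 (blocks G T) j) (𝓜 (blocks G T′) j)
      identity : ∀ {T} (p : T ⊆ T) j → F₁ p j ≈ʰ idʰ
      compose  : ∀ {T T′ T″} (p : T ⊆ T′) (q : T′ ⊆ T″) (r : T ⊆ T″) j →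
                 F₁ r j ≈ʰ F₁ q j ∘ʰ F₁ p j
      cycle    : ∀ {T e} → e ∉ T → (cyc : CompletesCycle G T e) →
                 (p : T ⊆ T ∪ ⁅ e ⁆) → ∀ j →
                 F₁ p j ≈ʰ 𝓜-≡ (completesCycle⇒blocks≡ G cyc) j

  open import Algebra.Properties.Semiring.Exp K.semiring using (_^_)

  -- The coefficient c(T ⋖ T ∪ {e}).
  sign : ∀ {m} → Subset m → Fin m → ∣K∣
  sign {m} T e = (K.- K.1#) ^ length (filter (λ f → f ∈? T ×-dec f Fin.<? e) (allFin m))

  module _ {n : ℕ} {G : Graph n} (F : ChromaticSymmetricFunctor G) where
    open Graph G
    open ChromaticSymmetricFunctor F

    F₀ : ℤ → Subset m → Rep (Sym n)
    F₀ j T = 𝓜 (blocks G T) j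

    -- The degree j part of C^i; the sum over the finitely many T is a product.
    Cochain : ℤ → ℤ → Rep (Sym n)
    Cochain i j = ∏ (OfSize m i) (F₀ j ∘ value)

    -- The component of δ at T′ sums c(T ⋖ T′) F(T ⋖ T′) over T = T′ ∖ {e}, e ∈ T′.
    δ : ∀ i {i′} → i′ ≡ ℤ.suc i → ∀ j → Hom (Cochain i j) (Cochain i′ j)
    δ i i′≡1+i j = tuple {M = F₀ j ∘ value} λ (T′ , [ ∣T′∣≡i′ ]) →
      ∑ʰ λ e → term T′ (trans ∣T′∣≡i′ i′≡1+i) e (e ∈? T′)
      where
      term : ∀ T′ → .(+ ∣ T′ ∣ ≡ ℤ.suc i) → ∀ e → Dec (e ∈ T′) → Hom (Cochain i j) (F₀ j T′)
      term T′ p e (yes e∈T′) = sign (T′ - e) e ·ʰ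
        (F₁ (p─q⊆p T′ ⁅ e ⁆) j ∘ʰ π {M = F₀ j ∘ value} (T′ - e , [ remove T′ p e∈T′ ]))
      term T′ p e (no _)     = 0ʰ

    H^CS : ℤ → ℤ → Rep (Sym n)
    H^CS i j = Homology (δ (ℤ.pred i) (sym (ℤ.suc-pred i)) j) (δ i refl j)

open Over ℂ public using (module Rep; ChromaticSymmetricFunctor; H^CS)

module Submission where

-- A block B with b points contributes exterior powers of the module S^(b-1,1), which is spanned
-- by the b - 1 vectors e_x - e_w for a fixed w in B; hence 𝓜_T lives in degrees from 0 to
-- the sum of the b - 1, which is at most |T|. This bounds j.
--
-- For i ≥ n the complex is exact, by deletion–contraction on the first edge: its total complex is
-- the cone of the map between the two faces of the cube (edge absent, edge present). If the edge
-- is a loop, that map is an isomorphism and the cone is exact. Otherwise contracting it lowers the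
-- number c of vertices by one, deleting it does not change c, and exactness in degrees ≥ c
-- on the deletion and ≥ c - 1 on the contraction gives exactness in degrees ≥ c on the cone.
-- Vertices are counted through `nonleast R`, the vertices that are not the least element of their
-- class under the equivalence relation R generated by the contracted edges.

open import Algebra.Bundles using (CommutativeRing; Group)
open import Algebra.Module.Bundles using (LeftModule)
import Algebra.Properties.CommutativeMonoid.Sum as Sum
import Algebra.Properties.Group as GroupProperties
import Algebra.Properties.Ring as RingProperties
open import Data.Bool.Base using (false; true; if_then_else_)
import Data.Bool.Properties as Bool
open import Data.Empty.Irrelevant using (⊥-elim)
open import Data.Fin.Base as Fin using (Fin; zero; suc; toℕ; fromℕ<)
open import Data.Fin.Induction using (<-wellFounded)
import Data.Fin.Properties as Fin
open import Data.Fin.Subset renaming (_-_ to _∖_)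
open import Data.Fin.Subset.Properties
open import Data.Integer.Base as ℤ using (ℤ; +_; -[1+_]; 0ℤ; 1ℤ; _-_; _≤_)
import Data.Integer.Properties as ℤ
open import Data.Irrelevant using ([_])
open import Data.List.Base as List using (List; []; _∷_; allFin; filter; length)
open import Data.List.Membership.Propositional.Properties using (∈-deduplicate⁻; ∈-map⁻)
import Data.List.Properties as List
open import Data.List.Relation.Unary.All as All using (All; []; _∷_)
open import Data.List.Relation.Unary.AllPairs using (AllPairs; []; _∷_)
open import Data.List.Relation.Unary.Unique.DecPropositional.Properties using (deduplicate-!)
open import Data.Nat.Base as ℕ using (ℕ; zero; suc; s≤s; z≤n)
import Data.Nat.Properties as ℕ
open import Data.Product.Base using (Σ-syntax; ∃-syntax; _×_; _,_; proj₁; proj₂)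
open import Data.Refinement.Base using (_,_)
open import Data.Sum.Base using (_⊎_; inj₁; inj₂; [_,_]′; map₂)
open import Data.Unit.Polymorphic.Base using (tt)
open import Data.Vec.Base as Vec using (Vec; []; _∷_; _[_]≔_; here; there; lookup; tabulate)
import Data.Vec.Properties as Vec
open import Data.Vec.Relation.Binary.Pointwise.Inductive as Pointwise using (Pointwise; []; _∷_)
open import Function.Base using (_∘_; case_of_; id)
open import Function.Bundles using (mk⇔)
import Induction.WellFounded as WF
open import Level using (0ℓ)
open import Relation.Binary.Construct.Closure.ReflexiveTransitive as Star
  using (Star; _◅_; _◅◅_; reverse) renaming (ε to stop)
open import Relation.Binary.Definitions using (Decidable; tri<; tri≈; tri>)
open import Relation.Binary.PropositionalEquality
  using (_≡_; _≢_; refl; sym; trans; cong; subst)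
import Relation.Binary.Reasoning.Setoid as SetoidReasoning
open import Relation.Binary.Structures using (IsDecEquivalence)
open import Relation.Nullary.Decidable
  using (Dec; yes; no; does; dec-true; dec-false; does-⇔; decidable-stable; recompute
        ; ¬?; _⊎-dec_; _×-dec_)
open import Relation.Nullary.Negation using (¬_; contradiction)
import Relation.Unary as U

open import Defs hiding (module Rep; ChromaticSymmetricFunctor; H^CS)

-- Finite subsets and their cardinalities

module _ {n : ℕ} where

  setOf : {P : Fin n → Set} → U.Decidable P → Subset n
  setOf P? = tabulate λ x → does (P? x)

  module _ {P : Fin n → Set} (P? : U.Decidable P) {x : Fin n} where

    ∈-setOf⁺ : P x → x ∈ setOf P?
    ∈-setOf⁺ px = Vec.lookup⇒[]= x (setOf P?)
      (trans (Vec.lookup∘tabulate (λ x → does (P? x)) x) (dec-true (P? x) px))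

    ∈-setOf⁻ : x ∈ setOf P? → P x
    ∈-setOf⁻ x∈ with P? x in eq
    ... | yes px = px
    ... | no _   = contradiction
      (trans (sym (Vec.[]=⇒lookup x∈))
        (trans (Vec.lookup∘tabulate (λ x → does (P? x)) x) (cong does eq)))
      λ ()

-- Numbering the elements of `p` makes the pigeonhole principle available for subsets.
index : ∀ {n} {p : Subset n} {x} → x ∈ p → Fin ∣ p ∣
index here                        = zero
index (there {y = inside} x∈p)  = suc (index x∈p)
index (there {y = outside} x∈p) = index x∈p

index-injective : ∀ {n} {p : Subset n} {x y} (x∈p : x ∈ p) (y∈p : y ∈ p) →
                  index x∈p ≡ index y∈p → x ≡ y
index-injective here here _ = refl
index-injective here (there {y = inside} _) ()
index-injective (there {y = inside} _) here ()
index-injective (there {y = inside} x∈p) (there y∈p) eq =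
  cong suc (index-injective x∈p y∈p (Fin.suc-injective eq))
index-injective (there {y = outside} x∈p) (there y∈p) eq =
  cong suc (index-injective x∈p y∈p eq)

∣p∩q∣+∣p─q∣≤∣p∣ : ∀ {n} (p q : Subset n) → ∣ p ∩ q ∣ ℕ.+ ∣ p ─ q ∣ ℕ.≤ ∣ p ∣
∣p∩q∣+∣p─q∣≤∣p∣ []            []            = z≤n
∣p∩q∣+∣p─q∣≤∣p∣ (outside ∷ p) (outside ∷ q) = ∣p∩q∣+∣p─q∣≤∣p∣ p q
∣p∩q∣+∣p─q∣≤∣p∣ (outside ∷ p) (inside ∷ q)  = ∣p∩q∣+∣p─q∣≤∣p∣ p q
∣p∩q∣+∣p─q∣≤∣p∣ (inside ∷ p)  (inside ∷ q)  = s≤s (∣p∩q∣+∣p─q∣≤∣p∣ p q)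
∣p∩q∣+∣p─q∣≤∣p∣ (inside ∷ p)  (outside ∷ q) =
  ℕ.≤-trans (ℕ.≤-reflexive (ℕ.+-suc ∣ p ∩ q ∣ ∣ p ─ q ∣)) (s≤s (∣p∩q∣+∣p─q∣≤∣p∣ p q))

x∈p─q⇒x∉q : ∀ {n} {p q : Subset n} {x} → x ∈ p ─ q → x ∉ q
x∈p─q⇒x∉q {p = _ ∷ _} {inside ∷ q}  (there x∈) (there x∈q) = x∈p─q⇒x∉q x∈ x∈q
x∈p─q⇒x∉q {p = _ ∷ _} {outside ∷ q} (there x∈) (there x∈q) = x∈p─q⇒x∉q x∈ x∈q

-- Removing from `p` the only element that can lie outside `q` leaves a subset of `q`.
∣p∣≤1+∣q∣ : ∀ {n} {p q : Subset n} →
             (∀ {x y} → x ∈ p → x ∉ q → y ∈ p → y ∉ q → x ≡ y) → ∣ p ∣ ℕ.≤ suc ∣ q ∣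
∣p∣≤1+∣q∣ {p = p} {q} unique with Fin.any? (λ x → x ∈? p ×-dec ¬? (x ∈? q))
... | no none = ℕ.m≤n⇒m≤1+n (p⊆q⇒∣p∣≤∣q∣ λ {x} x∈p →
  decidable-stable (x ∈? q) λ x∉q → none (x , x∈p , x∉q))
... | yes (w , w∈p , w∉q) = ℕ.≤-trans (ℕ.≤-reflexive (∣T∣≡1+∣T-e∣ p w∈p))
  (s≤s (p⊆q⇒∣p∣≤∣q∣ λ {x} x∈p-w → decidable-stable (x ∈? q) λ x∉q →
    x∉⁅y⁆⇒x≢y (x∈p─q⇒x∉q x∈p-w) (unique (p─q⊆p p ⁅ w ⁆ x∈p-w) x∉q w∈p w∉q)))

-- Least elements of classes, and merging of classes

module _ {n : ℕ} {R : Fin n → Fin n → Set} (R? : Decidable R) where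

  private
    below? : U.Decidable (λ v → ∃[ u ] u Fin.< v × R u v)
    below? v = Fin.any? λ u → u Fin.<? v ×-dec R? u v

  -- For an equivalence relation its size is n minus the number of classes; for `Joined edge T` this
  -- is the rank of `T` in the cycle matroid.
  nonleast : Subset n
  nonleast = setOf below?

  ∈-nonleast⁺ : ∀ {u v} → u Fin.< v → R u v → v ∈ nonleast
  ∈-nonleast⁺ u<v Ruv = ∈-setOf⁺ below? (_ , u<v , Ruv)

  ∈-nonleast⁻ : ∀ {v} → v ∈ nonleast → ∃[ u ] u Fin.< v × R u v
  ∈-nonleast⁻ = ∈-setOf⁻ below?

nonleast-mono : ∀ {n} {R R′ : Fin n → Fin n → Set} (R? : Decidable R) (R′? : Decidable R′) →
                (∀ {u v} → R u v → R′ u v) → nonleast R? ⊆ nonleast R′?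
nonleast-mono R? R′? R⇒R′ v∈ =
  let _ , u<v , Ruv = ∈-nonleast⁻ R? v∈ in ∈-nonleast⁺ R′? u<v (R⇒R′ Ruv)

-- `zero` has no vertex below it, so it is always missing from `nonleast`.
∣nonleast∣<n : ∀ {n} {R : Fin (suc n) → Fin (suc n) → Set} (R? : Decidable R) → ∣ nonleast R? ∣ ℕ.< suc n
∣nonleast∣<n {n} R? = subst (∣ nonleast R? ∣ ℕ.<_) (∣⊤∣≡n (suc n)) (p⊂q⇒∣p∣<∣q∣
  (⊆-max (nonleast R?) , zero , ∈⊤ , λ z∈ → ℕ.n≮0 (proj₁ (proj₂ (∈-nonleast⁻ R? z∈)))))

module _ {n : ℕ} {R : Fin n → Fin n → Set} (isDecEq : IsDecEquivalence R) where
  private module R = IsDecEquivalence isDecEq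

  -- Well-founded descent: a vertex that is not least has a smaller relative.
  least-representative : ∀ u → ∃[ v ] R u v × v ∉ nonleast R._≟_
  least-representative = WF.All.wfRec <-wellFounded _ _ λ u rec → case u ∈? nonleast R._≟_ of λ where
    (no u∉)  → u , R.refl , u∉
    (yes u∈) → let t , t<u , Rtu = ∈-nonleast⁻ R._≟_ u∈
                   v , Rtv , v∉ = rec t<u
               in v , R.trans (R.sym Rtu) Rtv , v∉

  unique-least : ∀ {u v} → R u v → u ∉ nonleast R._≟_ → v ∉ nonleast R._≟_ → u ≡ v
  unique-least {u} {v} Ruv u∉ v∉ with Fin.<-cmp u v
  ... | tri< u<v _ _ = contradiction (∈-nonleast⁺ R._≟_ u<v Ruv) v∉
  ... | tri≈ _ u≡v _ = u≡v
  ... | tri> _ _ v<u = contradiction (∈-nonleast⁺ R._≟_ v<u (R.sym Ruv)) u∉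

  module _ (e : Subset n) where

    Touches : Fin n → Set
    Touches u = ∃[ x ] R u x × x ∈ e

    -- The equivalence relation generated by `R` and by identifying the elements of `e`; the closed
    -- form keeps it decidable.
    Merge : Fin n → Fin n → Set
    Merge u v = R u v ⊎ Touches u × Touches v

    touches? : U.Decidable Touches
    touches? u = Fin.any? λ x → u R.≟ x ×-dec x ∈? e

    merge-isDecEquivalence : IsDecEquivalence Merge
    merge-isDecEquivalence = record
      { isEquivalence = record
        { refl  = inj₁ R.refl
        ; sym   = λ where
            (inj₁ Ruv)     → inj₁ (R.sym Ruv)
            (inj₂ (u , v)) → inj₂ (v , u)
        ; trans = λ where
            (inj₁ Ruv)     (inj₁ Rvw)               → inj₁ (R.trans Ruv Rvw)
            (inj₁ Ruv)     (inj₂ ((x , Rvx , x∈) , w)) → inj₂ ((x , R.trans Ruv Rvx , x∈) , w)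
            (inj₂ (u , (x , Rvx , x∈))) (inj₁ Rvw)  →
              inj₂ (u , (x , R.trans (R.sym Rvw) Rvx , x∈))
            (inj₂ (u , _)) (inj₂ (_ , w))           → inj₂ (u , w)
        }
      ; _≟_ = λ u v → u R.≟ v ⊎-dec (touches? u ×-dec touches? v)
      }

    private module M = IsDecEquivalence merge-isDecEquivalence

    -- The classes of `x` and `y` have distinct least elements; after merging, the greater of the
    -- two has a smaller relative.
    nonleast-merge-⊂ : ∀ {x y} → x ∈ e → y ∈ e → ¬ R x y → nonleast R._≟_ ⊂ nonleast M._≟_
    nonleast-merge-⊂ {x} {y} x∈ y∈ ¬Rxy =
      nonleast-mono R._≟_ M._≟_ inj₁ , greater (least-representative x) (least-representative y)
      where
      greater : (∃[ a ] R x a × a ∉ nonleast R._≟_) → (∃[ b ] R y b × b ∉ nonleast R._≟_) →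
                ∃[ v ] v ∈ nonleast M._≟_ × v ∉ nonleast R._≟_
      greater (a , Rxa , a∉) (b , Ryb , b∉) with Fin.<-cmp a b
      ... | tri< a<b _ _ = b , ∈-nonleast⁺ M._≟_ a<b (inj₂ ((x , R.sym Rxa , x∈) , (y , R.sym Ryb , y∈))) , b∉
      ... | tri≈ _ refl _ = contradiction (R.trans Rxa (R.sym Ryb)) ¬Rxy
      ... | tri> _ _ b<a = a , ∈-nonleast⁺ M._≟_ b<a (inj₂ ((y , R.sym Ryb , y∈) , (x , R.sym Rxa , x∈))) , a∉

    -- Of the least elements of the two merged classes only the greater one ceases to be least.
    ∣nonleast-merge∣≤ : ∣ e ∣ ℕ.≤ 2 → ∣ nonleast M._≟_ ∣ ℕ.≤ suc ∣ nonleast R._≟_ ∣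
    ∣nonleast-merge∣≤ ∣e∣≤2 = ∣p∣≤1+∣q∣ unique
      where
      two : ∀ {x y z} → x ∈ e → y ∈ e → z ∈ e → x ≢ y → z ≡ x ⊎ z ≡ y
      two {x} {y} {z} x∈ y∈ z∈ x≢y with Fin.pigeonhole (s≤s ∣e∣≤2)
        (λ where zero → index x∈ ; (suc zero) → index y∈ ; (suc (suc zero)) → index z∈)
      ... | suc _ , suc zero , s≤s () , _
      ... | suc (suc zero) , suc (suc zero) , s≤s (s≤s ()) , _
      ... | zero , suc zero , _ , eq = contradiction (index-injective x∈ y∈ eq) x≢y
      ... | zero , suc (suc zero) , _ , eq = inj₁ (sym (index-injective x∈ z∈ eq))
      ... | suc zero , suc (suc zero) , _ , eq = inj₂ (sym (index-injective y∈ z∈ eq))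

      -- If `v` stops being least, some smaller `u` lies in the other merged class, through `y`; the
      -- least element of that class is at most `u`, hence below `v`.
      lower : ∀ {v} → v ∈ nonleast M._≟_ → v ∉ nonleast R._≟_ →
              ∃[ x ] ∃[ y ] R v x × x ∈ e × y ∈ e × x ≢ y ×
              (∀ {w} → R w y → w ∉ nonleast R._≟_ → w Fin.< v)
      lower {v} v∈ v∉ with ∈-nonleast⁻ M._≟_ v∈
      ... | u , u<v , inj₁ Ruv = contradiction (∈-nonleast⁺ R._≟_ u<v Ruv) v∉
      ... | u , u<v , inj₂ ((y , Ruy , y∈) , (x , Rvx , x∈)) =
        x , y , Rvx , x∈ , y∈
          , (λ { refl → v∉ (∈-nonleast⁺ R._≟_ u<v (R.trans Ruy (R.sym Rvx))) })
          , λ {w} Rwy w∉ → ℕ.≤-<-trans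
              (ℕ.≮⇒≥ λ u<w → w∉ (∈-nonleast⁺ R._≟_ u<w (R.trans Ruy (R.sym Rwy)))) u<v

      unique : ∀ {v w} → v ∈ nonleast M._≟_ → v ∉ nonleast R._≟_ →
               w ∈ nonleast M._≟_ → w ∉ nonleast R._≟_ → v ≡ w
      unique v∈ v∉ w∈ w∉ with lower v∈ v∉ | lower w∈ w∉
      ... | x , y , Rvx , x∈ , y∈ , x≢y , <v | x′ , y′ , Rwx′ , x′∈ , y′∈ , x′≢y′ , <w
        with two x∈ y∈ x′∈ x≢y
      ...   | inj₁ refl = unique-least (R.trans Rvx (R.sym Rwx′)) v∉ w∉
      ...   | inj₂ refl with two y∈ x∈ y′∈ (x≢y ∘ sym)
      ...     | inj₁ refl = contradiction refl x′≢y′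
      -- The classes of `v` and `w` meet `e` in opposite ends, so each of the two would lie below
      -- the other.
      ...     | inj₂ refl = contradiction (<w Rvx v∉) (ℕ.<-asym (<v Rwx′ w∉))

-- Connected components of spanning subgraphs

module _ {n : ℕ} where

  joined-isDecEquivalence : ∀ {m} (edge : Fin m → Subset n) (T : Subset m) →
                            IsDecEquivalence (Joined edge T)
  joined-isDecEquivalence edge T = record
    { isEquivalence = record
      { refl  = stop
      ; sym   = reverse λ (e , e∈ , u∈ , v∈) → e , e∈ , v∈ , u∈
      ; trans = _◅◅_
      }
    ; _≟_ = joined? edge T
    }

  joined-outside : ∀ {m} {edge : Fin (suc m) → Subset n} {T u v} →
                   Joined edge (outside ∷ T) u v → Joined (edge ∘ suc) T u v
  joined-outside stop = stop
  joined-outside ((suc e , e∈ , u∈ , w∈) ◅ p) = (e , drop-there e∈ , u∈ , w∈) ◅ joined-outside p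

  joined-inside : ∀ {m} {edge : Fin (suc m) → Subset n} {T u v} → Joined edge (inside ∷ T) u v →
                  Merge (joined-isDecEquivalence (edge ∘ suc) T) (edge zero) u v
  joined-inside {edge = edge} {T} = go
    where
    module M = IsDecEquivalence (merge-isDecEquivalence (joined-isDecEquivalence (edge ∘ suc) T) (edge zero))
    go : ∀ {u v} → Joined edge (inside ∷ T) u v → _
    go stop = M.refl
    go ((zero , _ , u∈ , w∈) ◅ p) = M.trans (inj₂ ((_ , stop , u∈) , (_ , stop , w∈))) (go p)
    go ((suc e , e∈ , u∈ , w∈) ◅ p) = M.trans (inj₁ ((e , drop-there e∈ , u∈ , w∈) ◅ stop)) (go p)

  -- Without edges all classes are singletons, and each edge of `T` merges at most two classes,
  -- which raises the count by at most one.
  ∣nonleast-joined∣≤ : ∀ {m} (edge : Fin m → Subset n) → (∀ e → ∣ edge e ∣ ≡ 2) → ∀ T →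
                       ∣ nonleast (joined? edge T) ∣ ℕ.≤ ∣ T ∣
  ∣nonleast-joined∣≤ edge size [] = ℕ.≤-trans
    (p⊆q⇒∣p∣≤∣q∣ {q = ⊥} λ v∈ → case ∈-nonleast⁻ (joined? edge []) v∈ of λ where
      (u , u<u , stop) → contradiction u<u (ℕ.<-irrefl refl))
    (ℕ.≤-reflexive (∣⊥∣≡0 n))
  ∣nonleast-joined∣≤ edge size (outside ∷ T) = ℕ.≤-trans
    (p⊆q⇒∣p∣≤∣q∣ (nonleast-mono (joined? edge (outside ∷ T)) (joined? (edge ∘ suc) T) joined-outside))
    (∣nonleast-joined∣≤ (edge ∘ suc) (size ∘ suc) T)
  ∣nonleast-joined∣≤ edge size (inside ∷ T) = ℕ.≤-trans
    (p⊆q⇒∣p∣≤∣q∣ (nonleast-mono (joined? edge (inside ∷ T)) M._≟_ joined-inside))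
    (ℕ.≤-trans (∣nonleast-merge∣≤ joinedᵀ (edge zero) (ℕ.≤-reflexive (size zero)))
      (s≤s (∣nonleast-joined∣≤ (edge ∘ suc) (size ∘ suc) T)))
    where
    joinedᵀ = joined-isDecEquivalence (edge ∘ suc) T
    module M = IsDecEquivalence (merge-isDecEquivalence joinedᵀ (edge zero))

  Disjoint : Subset n → Subset n → Set
  Disjoint B C = ∀ x → x ∈ B → x ∉ C

  -- Gives |B| - 1 ≤ |N ∩ B|, so that for disjoint blocks the numbers |B| - 1 add up to at most |N|.
  AlmostWithin : Subset n → Subset n → Set
  AlmostWithin N B = ∃[ w ] w ∈ B × B ∖ w ⊆ N

module _ {n : ℕ} (G : Graph n) where
  open Graph G

  module _ (T : Subset m) where
    private
      module J = IsDecEquivalence (joined-isDecEquivalence edge T)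

      IsComponent : Subset n → Set
      IsComponent B = ∃[ u ] B ≡ component G T u

    blocks-components : All IsComponent (blocks G T)
    blocks-components = All.tabulate λ B∈ →
      let u , _ , eq = ∈-map⁻ (component G T) (∈-deduplicate⁻ _ (List.map (component G T) (allFin n)) B∈)
      in u , eq

    components-disjoint : ∀ {B C} → IsComponent B → IsComponent C → B ≢ C → Disjoint B C
    components-disjoint (u , refl) (v , refl) B≢C _ x∈B x∈C = B≢C (Vec.tabulate-cong λ w →
      does-⇔ (mk⇔ (J.trans Jvu) (J.trans (J.sym Jvu))) (joined? edge T u w) (joined? edge T v w))
      where
      Jvu : Joined edge T v u
      Jvu = J.trans (∈-setOf⁻ (joined? edge T v) x∈C) (J.sym (∈-setOf⁻ (joined? edge T u) x∈B))

    blocks-disjoint : AllPairs Disjoint (blocks G T)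
    blocks-disjoint = go blocks-components (deduplicate-! (Vec.≡-dec Bool._≟_) _)
      where
      go : ∀ {P} → All IsComponent P → AllPairs _≢_ P → AllPairs Disjoint P
      go []       []       = []
      go (c ∷ cs) (d ∷ ds) =
        All.zipWith (λ (c′ , d′) → components-disjoint c c′ d′) (cs , d) ∷ go cs ds

    -- The omitted `w` is the least vertex of the component; any other vertex outside `N` would also
    -- be least, hence equal to `w`.
    blocks-almostWithin : All (AlmostWithin (nonleast (joined? edge T))) (blocks G T)
    blocks-almostWithin = All.map (λ { (u , refl) → almost u }) blocks-components
      where
      N = nonleast (joined? edge T)
      almost : ∀ u → AlmostWithin N (component G T u)
      almost u =
        let w , Juw , w∉ = least-representative (joined-isDecEquivalence edge T) u in
        w , ∈-setOf⁺ (joined? edge T u) Juw , λ {v} v∈ → decidable-stable (v ∈? N) λ v∉ →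
          x∉⁅y⁆⇒x≢y (x∈p─q⇒x∉q v∈)
            (unique-least (joined-isDecEquivalence edge T)
              (J.trans (J.sym (∈-setOf⁻ (joined? edge T u) (p─q⊆p (component G T u) ⁅ w ⁆ v∈))) Juw)
              v∉ w∉)

-- Comparing filters over two index types lets the count in `sign` be shifted from `suc e` to `e`.
length-filter-tabulate : ∀ {A B : Set} {P : A → Set} {Q : B → Set}
  (P? : U.Decidable P) (Q? : U.Decidable Q) {m} (f : Fin m → A) (g : Fin m → B) → (∀ i → does (P? (f i)) ≡ does (Q? (g i))) →
  length (filter P? (List.tabulate f)) ≡ length (filter Q? (List.tabulate g))
length-filter-tabulate P? Q? {zero}  f g eq = refl
length-filter-tabulate P? Q? {suc m} f g eq with does (P? (f zero)) | does (Q? (g zero)) | eq zero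
... | false | _ | refl = length-filter-tabulate P? Q? (f ∘ suc) (g ∘ suc) (eq ∘ suc)
... | true  | _ | refl = cong suc (length-filter-tabulate P? Q? (f ∘ suc) (g ∘ suc) (eq ∘ suc))

module _ (K : CommutativeRing 0ℓ 0ℓ) where
  open Over K
  open Hom using (⟦_⟧)

  private
    _[_≈_] : ∀ {G} (M : Rep G) → Rep.Carrierᴹ M → Rep.Carrierᴹ M → Set
    _[_≈_] = Rep._≈ᴹ_

  -- Submodules and spanning families

  private module _ {V : LeftModule K.ring 0ℓ 0ℓ} where
    open LeftModule V

    record IsSubmodule (Z : Carrierᴹ → Set) : Set where
      field
        resp : ∀ {x y} → x ≈ᴹ y → Z y → Z x
        0∈   : Z 0ᴹ
        +∈   : ∀ {x y} → Z x → Z y → Z (x +ᴹ y)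
        *∈   : ∀ r {x} → Z x → Z (r *ₗ x)

      open Sum +ᴹ-commutativeMonoid using (sum)

      sum∈ : ∀ {m} {f : Fin m → Carrierᴹ} → (∀ i → Z (f i)) → Z (sum f)
      sum∈ {zero}  Zf = 0∈
      sum∈ {suc m} Zf = +∈ (Zf zero) (sum∈ (Zf ∘ suc))

    -- Phrased as an induction principle over submodules instead of by linear combinations, the form
    -- in which multilinearity applies.
    Spans : {I : Set} → (I → Carrierᴹ) → Set₁
    Spans b = ∀ {Z} → IsSubmodule Z → (∀ i → Z (b i)) → ∀ v → Z v

  -- Vanishing of induced modules, tensor products and exterior powers

  presented-zero : ∀ {X : Set} {R : Term X → Term X → Set} →
                   (∀ x → Cong R (gen x) 𝟘) → ∀ t → Cong R t 𝟘
  presented-zero         z (gen x) = z x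
  presented-zero         z 𝟘       = ≈-refl
  presented-zero         z (s ⊕ t) = ≈-trans (⊕-cong (presented-zero z s) (presented-zero z t)) (⊕-identity 𝟘)
  presented-zero {R = R} z (r ⊙ t) =
    ≈-trans (⊙-cong K.refl (presented-zero z t)) (LeftModule.*ₗ-zeroʳ (presented R) r)

  -- Supplies a factor 0 that homogeneity of the generators can pull out.
  zero≈0* : ∀ {G} {M : Rep G} → Rep.IsZero M → ∀ x → M [ x ≈ Rep._*ₗ_ M K.0# x ]
  zero≈0* {M = M} z x = ≈ᴹ-trans (z x) (≈ᴹ-sym (*ₗ-zeroˡ x))
    where open Rep M

  Ind-zero : ∀ {H G} (φ : GroupHom H G) (W : Rep H) → Rep.IsZero W → Rep.IsZero (Ind φ W)
  Ind-zero {G = G} φ W z = presented-zero λ (g , w) →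
    ≈-trans (rel (congruent (Group.refl G) (zero≈0* {M = W} z w)))
    (≈-trans (rel (homogeneous g K.0# w)) (⊙-zero _))

  ⊗-zero : ∀ {G} (A B : GradedRep G) j →
           (∀ p q → p ℤ.+ q ≡ j → Rep.IsZero (A p) ⊎ Rep.IsZero (B q)) → Rep.IsZero ((A ⊗ B) j)
  ⊗-zero A B j z = presented-zero λ (pure p q p+q≡j a b) →
    [ (λ zA → ≈-trans (rel (congruent (zero≈0* {M = A p} zA a) (Rep.≈ᴹ-refl (B q))))
              (≈-trans (rel (homogeneousˡ K.0# a b)) (⊙-zero _)))
    , (λ zB → ≈-trans (rel (congruent (Rep.≈ᴹ-refl (A p)) (zero≈0* {M = B q} zB b)))
              (≈-trans (rel (homogeneousʳ K.0# a b)) (⊙-zero _)))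
    ]′ (z p q p+q≡j)

  module _ {G : Group 0ℓ 0ℓ} (V : Rep G) (k : ℕ) where
    open Rep V

    -- Multilinearity in slot `i`; with `Spans` it reduces the vanishing of a wedge to spanning
    -- vectors in that slot.
    slot-isSubmodule : ∀ vs i → IsSubmodule {leftModule} (λ w → Cong (⋀-Relation V k) (gen (vs [ i ]≔ w)) 𝟘)
    slot-isSubmodule vs i = record
      { resp = λ x≈y z → ≈-trans (rel (congruent (update vs i x≈y))) z
      ; 0∈   = ≈-trans (rel (congruent (update vs i (≈ᴹ-sym (*ₗ-zeroˡ 0ᴹ)))))
                 (≈-trans (rel (homogeneous vs i K.0# 0ᴹ)) (⊙-zero _))
      ; +∈   = λ z z′ → ≈-trans (rel (additive vs i _ _)) (≈-trans (⊕-cong z z′) (⊕-identity 𝟘))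
      ; *∈   = λ r z → ≈-trans (rel (homogeneous vs i r _)) (≈-trans (⊙-cong K.refl z)
                 (LeftModule.*ₗ-zeroʳ (presented (⋀-Relation V k)) r))
      }
      where
      update : ∀ {l x y} (vs : Vec Carrierᴹ l) i → x ≈ᴹ y → Pointwise _≈ᴹ_ (vs [ i ]≔ x) (vs [ i ]≔ y)
      update (v ∷ vs) zero    p = p ∷ Pointwise.refl ≈ᴹ-refl
      update (v ∷ vs) (suc i) p = ≈ᴹ-refl ∷ update vs i p

    -- Multilinearity replaces the slots by spanning vectors, from the last to the first. Then two
    -- of the k > d slots share an index under `ι`, and the wedge vanishes by alternation.
    ⋀-zero : ∀ {d} {I : Set} (b : I → Carrierᴹ) → Spans {leftModule} b →
             (ι : I → Fin d) → (∀ {x y} → ι x ≡ ι y → b x ≈ᴹ b y) → d ℕ.< k → Rep.IsZero (⋀ V k)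
    ⋀-zero {d} {I} b spans ι ι-injective d<k = presented-zero λ vs →
      -- The descent starts at `k`, where `BasisFrom` asks nothing: no slot has position `k` or
      -- more.
      basisFrom⇒0 k vs λ i k≤i → contradiction (Fin.toℕ<n i) (ℕ.≤⇒≯ k≤i)
      where
      _≈0 : Vec Carrierᴹ k → Set
      vs ≈0 = Cong (⋀-Relation V k) (gen vs) 𝟘

      BasisFrom : ℕ → Vec Carrierᴹ k → Set
      BasisFrom l vs = ∀ i → l ℕ.≤ toℕ i → ∃[ x ] lookup vs i ≡ b x

      basisFrom⇒0 : ∀ l vs → BasisFrom l vs → vs ≈0
      basisFrom⇒0 zero vs basis =
        let i , j , i<j , eq = Fin.pigeonhole d<k (λ i → ι (proj₁ (basis i z≤n)))
            x , vᵢ≡x = basis i z≤n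
            y , vⱼ≡y = basis j z≤n
        in rel (alternating (Fin.<⇒≢ i<j)
             (≈ᴹ-trans (≈ᴹ-reflexive vᵢ≡x) (≈ᴹ-trans (ι-injective eq) (≈ᴹ-reflexive (sym vⱼ≡y)))))
      basisFrom⇒0 (suc l) vs basis with l ℕ.<? k
      ... | no l≮k  = basisFrom⇒0 l vs λ i l≤i →
        contradiction (ℕ.≤-<-trans l≤i (Fin.toℕ<n i)) l≮k
      ... | yes l<k = subst _≈0 (Vec.[]≔-lookup vs at-l)
        (spans (slot-isSubmodule vs at-l) (λ x → basisFrom⇒0 l _ (extend x)) (lookup vs at-l))
        where
        at-l : Fin k
        at-l = fromℕ< l<k

        extend : ∀ x → BasisFrom l (vs [ at-l ]≔ b x)
        extend x i l≤i with i Fin.≟ at-l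
        ... | yes refl = x , Vec.lookup∘update i vs (b x)
        ... | no i≢l   =
          let y , eq = basis i (ℕ.≤∧≢⇒< l≤i λ l≡i →
                i≢l (Fin.toℕ-injective (trans (sym l≡i) (sym (Fin.toℕ-fromℕ< l<k)))))
          in y , trans (Vec.lookup∘update′ i≢l vs (b x)) eq

  -- The standard representation

  private
    kron : ∀ {n} → Fin n → Fin n → K.Carrier
    kron x y = if does (x Fin.≟ y) then K.1# else K.0#

    kron-≢ : ∀ {n} (x y : Fin n) → x ≢ y → kron x y ≡ K.0#
    kron-≢ x y x≢y = cong (if_then K.1# else K.0#) (dec-false (x Fin.≟ y) x≢y)

  open Sum K.+-commutativeMonoid using (sum; sum-cong-≋; ∑-distrib-+; sum-replicate-zero)
  open import Algebra.Properties.Semiring.Sum K.semiring using (*-distribˡ-sum; *-distribʳ-sum)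
  open RingProperties K.ring using (-1*x≈-x; -0#≈0#)

  sum-kron : ∀ {n} (x : Fin n) → sum (kron x) K.≈ K.1#
  sum-kron {suc n} zero    = K.trans (K.+-congˡ (sum-replicate-zero n)) (K.+-identityʳ K.1#)
  sum-kron {suc n} (suc x) = K.trans (K.+-identityˡ _) (sum-kron x)

  sum-*kron : ∀ {n} (f : Fin n → K.Carrier) y → sum (λ x → f x K.* kron x y) K.≈ f y
  sum-*kron {suc n} f zero = K.trans
    (K.+-cong (K.*-identityʳ (f zero))
      (K.trans (sum-cong-≋ λ x → K.zeroʳ (f (suc x))) (sum-replicate-zero n)))
    (K.+-identityʳ (f zero))
  sum-*kron {suc n} f (suc y) =
    K.trans (K.+-cong (K.zeroʳ (f zero)) (sum-*kron (f ∘ suc) y)) (K.+-identityˡ (f (suc y)))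

  module _ {n : ℕ} {B : Subset n} {w : Fin n} (w∈B : w ∈ B) where
    private module S = Rep (S⟨b-1,1⟩ B)
    open StandardVector

    difference : ∃[ x ] x ∈ B ∖ w → StandardVector B
    difference (x , x∈) = record
      { at        = λ y → kron x y K.- kron w y
      ; supported = λ y y∉B → K.trans
          (K.+-cong (K.reflexive (kron-≢ x y (λ { refl → y∉B (p─q⊆p B ⁅ w ⁆ x∈) })))
            (K.trans (K.-‿cong (K.reflexive (kron-≢ w y (λ { refl → y∉B w∈B })))) -0#≈0#))
          (K.+-identityˡ K.0#)
      ; sum≈0     = K.trans (∑-distrib-+ (kron x) (λ y → K.- kron w y))
          (K.trans (K.+-cong (sum-kron x) sum-negkron) (K.-‿inverseʳ K.1#))
      }
      where
      sum-negkron : sum (λ y → K.- kron w y) K.≈ K.- K.1#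
      sum-negkron = K.trans (sum-cong-≋ λ y → K.sym (-1*x≈-x (kron w y)))
        (K.trans (K.sym (*-distribˡ-sum (K.- K.1#) (kron w)))
          (K.trans (K.*-congˡ (sum-kron w)) (K.*-identityʳ (K.- K.1#))))

    private
      open Sum S.+ᴹ-commutativeMonoid renaming (sum to sumˢ) using ()

      at-sum : ∀ {m} (f : Fin m → StandardVector B) y → at (sumˢ f) y K.≈ sum (λ x → at (f x) y)
      at-sum {zero}  f y = K.refl
      at-sum {suc m} f y = K.+-congˡ (at-sum (f ∘ suc) y)

    -- v = Σ v(x)(e_x - e_w), because e_w gets the total coefficient -Σ v(x) = 0.
    difference-spans : Spans {S.leftModule} difference
    difference-spans {Z} isSub Zb v = resp v≈∑ (sum∈ term∈)
      where
      open IsSubmodule isSub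

      term : Fin n → StandardVector B
      term x with x ∈? B ∖ w
      ... | yes x∈ = at v x S.*ₗ difference (x , x∈)
      ... | no _   = S.0ᴹ

      term∈ : ∀ x → Z (term x)
      term∈ x with x ∈? B ∖ w
      ... | yes x∈ = *∈ (at v x) (Zb (x , x∈))
      ... | no _   = 0∈

      -- The omitted terms fit the same formula: the difference is zero at x = w, and v(x) = 0
      -- outside B.
      at-term : ∀ y x → at (term x) y K.≈ at v x K.* (kron x y K.- kron w y)
      at-term y x with x ∈? B ∖ w
      ... | yes _ = K.refl
      ... | no x∉ with x Fin.≟ w
      ...   | yes refl = K.sym (K.trans (K.*-congˡ (K.-‿inverseʳ (kron x y))) (K.zeroʳ (at v x)))
      ...   | no x≢w   = K.sym (K.trans
        (K.*-congʳ (supported v x λ x∈B → x∉ (x∈p∧x≢y⇒x∈p-y x∈B x≢w)))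
        (K.zeroˡ (kron x y K.- kron w y)))

      v≈∑ : v S.≈ᴹ sumˢ term
      v≈∑ y = K.sym (begin
        at (sumˢ term) y                                          ≈⟨ at-sum term y ⟩
        sum (λ x → at (term x) y)                                 ≈⟨ sum-cong-≋ (at-term y) ⟩
        sum (λ x → at v x K.* (kron x y K.- kron w y))
          ≈⟨ sum-cong-≋ (λ x → K.distribˡ (at v x) (kron x y) _) ⟩
        sum (λ x → at v x K.* kron x y K.+ at v x K.* (K.- kron w y))
          ≈⟨ ∑-distrib-+ (λ x → at v x K.* kron x y) _ ⟩
        sum (λ x → at v x K.* kron x y) K.+ sum (λ x → at v x K.* (K.- kron w y))
          ≈⟨ K.+-cong (sum-*kron (at v) y) (K.sym (*-distribʳ-sum (K.- kron w y) (at v))) ⟩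
        at v y K.+ sum (at v) K.* (K.- kron w y)                     ≈⟨ K.+-congˡ (K.*-congʳ (sum≈0 v)) ⟩
        at v y K.+ K.0# K.* (K.- kron w y)                           ≈⟨ K.+-congˡ (K.zeroˡ (K.- kron w y)) ⟩
        at v y K.+ K.0#                                           ≈⟨ K.+-identityʳ (at v y) ⟩
        at v y                                                    ∎)
        where open SetoidReasoning K.setoid

    𝓛-zero : ∀ {k} → ∣ B ∖ w ∣ ℕ.< k → Rep.IsZero (𝓛 B (+ k))
    𝓛-zero {k} = ⋀-zero (S⟨b-1,1⟩ B) k difference difference-spans
      (index ∘ proj₂) λ {x} {y} eq z → K.reflexive
        (cong (λ u → kron u z K.- kron w z) (index-injective (proj₂ x) (proj₂ y) eq))

  -- Degree bounds for the modules `𝓜`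

  module _ {n : ℕ} where

    ⨂𝓛-zero-below : ∀ (P : List (Subset n)) j → Rep.IsZero (⨂𝓛 P -[1+ j ])
    ⨂𝓛-zero-below []      j = λ _ → tt
    ⨂𝓛-zero-below (B ∷ P) j = ⊗-zero (Res restrictHead ∘ 𝓛 B) (Res restrictTail ∘ ⨂𝓛 P) -[1+ j ] λ where
      -[1+ _ ] _        _  → inj₁ λ _ → tt
      (+ _)    -[1+ q ] _  → inj₂ (⨂𝓛-zero-below P q)
      (+ _)    (+ _)    ()

    -- Induction on the blocks: `B` uses up the part of `N` inside it, and by disjointness the other
    -- blocks stay almost within `N ─ B`. A summand with both factors nonzero has p ≤ |B| - 1 ≤ |N ∩
    -- B| and q ≤ |N ─ B|.
    ⨂𝓛-zero-above : ∀ (P : List (Subset n)) {N} → AllPairs Disjoint P → All (AlmostWithin N) P →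
                    ∀ {j} → ∣ N ∣ ℕ.< j → Rep.IsZero (⨂𝓛 P (+ j))
    ⨂𝓛-zero-above []      []       []                        {suc j} _     = λ _ → tt
    ⨂𝓛-zero-above (B ∷ P) {N} (d ∷ ds) ((w , w∈B , B-w⊆N) ∷ ws) {j} N<j =
      ⊗-zero (Res restrictHead ∘ 𝓛 B) (Res restrictTail ∘ ⨂𝓛 P) (+ j) λ where
        -[1+ _ ] _        _ → inj₁ λ _ → tt
        (+ _)    -[1+ q ] _ → inj₂ (⨂𝓛-zero-below P q)
        (+ p)    (+ q)    e → split p q (ℤ.+-injective e)
      where
      ws′ : All (AlmostWithin (N ─ B)) P
      ws′ = All.zipWith (λ { (B∩C=∅ , C-w⊆N) → shrink B∩C=∅ C-w⊆N }) (d , ws)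
        where
        shrink : ∀ {C} → Disjoint B C → AlmostWithin N C → AlmostWithin (N ─ B) C
        shrink {C} B∩C=∅ (w , w∈C , C-w⊆N) = w , w∈C , λ {x} x∈ →
          x∈p∧x∉q⇒x∈p─q (C-w⊆N x∈) λ x∈B → B∩C=∅ x x∈B (p─q⊆p C ⁅ w ⁆ x∈)

      split : ∀ p q → p ℕ.+ q ≡ j → Rep.IsZero (𝓛 B (+ p)) ⊎ Rep.IsZero (⨂𝓛 P (+ q))
      split p q p+q≡j with ∣ B ∖ w ∣ ℕ.<? p | ∣ N ─ B ∣ ℕ.<? q
      ... | yes B-w<p | _         = inj₁ (𝓛-zero w∈B B-w<p)
      ... | no _      | yes N─B<q = inj₂ (⨂𝓛-zero-above P ds ws′ N─B<q)
      ... | no B-w≮p  | no N─B≮q  = contradiction N<j (ℕ.≤⇒≯ (begin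
        j                        ≡⟨ p+q≡j ⟨
        p ℕ.+ q                  ≤⟨ ℕ.+-mono-≤ (ℕ.≮⇒≥ B-w≮p) (ℕ.≮⇒≥ N─B≮q) ⟩
        ∣ B ∖ w ∣ ℕ.+ ∣ N ─ B ∣  ≤⟨ ℕ.+-monoˡ-≤ ∣ N ─ B ∣ (p⊆q⇒∣p∣≤∣q∣ λ x∈ →
                                      x∈p∩q⁺ (B-w⊆N x∈ , p─q⊆p B ⁅ w ⁆ x∈)) ⟩
        ∣ N ∩ B ∣ ℕ.+ ∣ N ─ B ∣  ≤⟨ ∣p∩q∣+∣p─q∣≤∣p∣ N B ⟩
        ∣ N ∣                    ∎))
        where open ℕ.≤-Reasoning

    𝓜-zero-below : ∀ (P : List (Subset n)) j → Rep.IsZero (𝓜 P -[1+ j ])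
    𝓜-zero-below P j = Ind-zero (inclusion P) (⨂𝓛 P -[1+ j ]) (⨂𝓛-zero-below P j)

    𝓜-zero-above : ∀ (G : Graph n) T {j} → ∣ T ∣ ℕ.< j → Rep.IsZero (𝓜 (blocks G T) (+ j))
    𝓜-zero-above G T {j} T<j = Ind-zero (inclusion (blocks G T)) (⨂𝓛 (blocks G T) (+ j))
      (⨂𝓛-zero-above (blocks G T) (blocks-disjoint G T) (blocks-almostWithin G T)
        (ℕ.≤-<-trans (∣nonleast-joined∣≤ (Graph.edge G) (Graph.edge-size G) T) T<j))

  -- Cubes of representations

  open import Algebra.Properties.Semiring.Exp K.semiring using (_^_)
  open GroupProperties K.+-group using (⁻¹-involutive)

  sign-zero : ∀ {m} (T : Subset (suc m)) → sign T zero ≡ K.1#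
  sign-zero {m} T = cong (λ fs → (K.- K.1#) ^ length fs)
    (List.filter-none (λ f → f ∈? T ×-dec f Fin.<? zero {m})
      (All.universal (λ { _ (_ , ()) }) (allFin (suc m))))

  sign-outside : ∀ {m} (T : Subset m) e → sign (outside ∷ T) (suc e) ≡ sign T e
  sign-outside T e = cong (λ k → (K.- K.1#) ^ k)
    (length-filter-tabulate _ (λ f → f ∈? T ×-dec f Fin.<? e) suc id λ _ → refl)

  -- The first edge precedes all others, so its presence costs a factor -1; this is the sign in the
  -- cone differential.
  sign-inside : ∀ {m} (T : Subset m) e → sign (inside ∷ T) (suc e) ≡ (K.- K.1#) K.* sign T e
  sign-inside T e = cong (λ k → (K.- K.1#) ^ (suc k))
    (length-filter-tabulate _ (λ f → f ∈? T ×-dec f Fin.<? e) suc id λ _ → refl)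

  module _ {G : Group 0ℓ 0ℓ} where

    module Negation (M : Rep G) where
      open Rep M
      open SetoidReasoning ≈ᴹ-setoid

      -y+y≈0 : ∀ y → (K.- K.1#) *ₗ y +ᴹ y ≈ᴹ 0ᴹ
      -y+y≈0 y = begin
        (K.- K.1#) *ₗ y +ᴹ y            ≈⟨ +ᴹ-congˡ (*ₗ-identityˡ y) ⟨
        (K.- K.1#) *ₗ y +ᴹ K.1# *ₗ y    ≈⟨ *ₗ-distribʳ y (K.- K.1#) K.1# ⟨
        (K.- K.1# K.+ K.1#) *ₗ y        ≈⟨ *ₗ-congʳ (K.-‿inverseˡ K.1#) ⟩
        K.0# *ₗ y                       ≈⟨ *ₗ-zeroˡ y ⟩
        0ᴹ                              ∎

      y-y≈0 : ∀ y → y +ᴹ (K.- K.1#) *ₗ y ≈ᴹ 0ᴹ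
      y-y≈0 y = ≈ᴹ-trans (+ᴹ-comm y _) (-y+y≈0 y)

      -‿involutive : ∀ y → (K.- K.1#) *ₗ ((K.- K.1#) *ₗ y) ≈ᴹ y
      -‿involutive y = begin
        (K.- K.1#) *ₗ ((K.- K.1#) *ₗ y)   ≈⟨ *ₗ-assoc (K.- K.1#) (K.- K.1#) y ⟨
        ((K.- K.1#) K.* (K.- K.1#)) *ₗ y  ≈⟨ *ₗ-congʳ (K.trans (-1*x≈-x (K.- K.1#)) (⁻¹-involutive K.1#)) ⟩
        K.1# *ₗ y                         ≈⟨ *ₗ-identityˡ y ⟩
        y                                 ∎

      x-y+y≈x : ∀ x y → (x +ᴹ (K.- K.1#) *ₗ y) +ᴹ y ≈ᴹ x
      x-y+y≈x x y = begin
        (x +ᴹ (K.- K.1#) *ₗ y) +ᴹ y  ≈⟨ +ᴹ-assoc x _ y ⟩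
        x +ᴹ ((K.- K.1#) *ₗ y +ᴹ y)  ≈⟨ +ᴹ-congˡ (-y+y≈0 y) ⟩
        x +ᴹ 0ᴹ                      ≈⟨ +ᴹ-identityʳ x ⟩
        x                            ∎

      x-y≈0⇒x≈y : ∀ {x y} → x +ᴹ (K.- K.1#) *ₗ y ≈ᴹ 0ᴹ → x ≈ᴹ y
      x-y≈0⇒x≈y {x} {y} p = ≈ᴹ-trans (≈ᴹ-sym (x-y+y≈x x y)) (≈ᴹ-trans (+ᴹ-congʳ p) (+ᴹ-identityˡ y))

    IsIso : {M N : Rep G} → Hom M N → Set
    IsIso {M} {N} f = Σ[ g ∈ Hom N M ] f ∘ʰ g ≈ʰ idʰ × g ∘ʰ f ≈ʰ idʰ

    -- The two families may have different sources, so that a sum over `Cochain` can be compared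
    -- with one over `Chain`.
    ∑ʰ-cong : ∀ {L M N : Rep G} {k} (f : Fin k → Hom L N) (g : Fin k → Hom M N) {x y} →
              (∀ e → N [ ⟦ f e ⟧ x ≈ ⟦ g e ⟧ y ]) →
              N [ ⟦ ∑ʰ f ⟧ x ≈ ⟦ ∑ʰ g ⟧ y ]
    ∑ʰ-cong {N = N} {k = zero}  f g p = Rep.≈ᴹ-refl N
    ∑ʰ-cong {N = N} {k = suc k} f g p = Rep.+ᴹ-cong N (p zero) (∑ʰ-cong (f ∘ suc) (g ∘ suc) (p ∘ suc))

  record Cube (G : Group 0ℓ 0ℓ) (q : ℕ) : Set₁ where
    field
      M       : Subset q → Rep G
      map     : ∀ {T T′} → T ⊆ T′ → Hom (M T) (M T′)
      map-id  : ∀ {T} (p : T ⊆ T) → map p ≈ʰ idʰ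
      map-∘   : ∀ {T T′ T″} (p : T ⊆ T′) (q : T′ ⊆ T″) (r : T ⊆ T″) → map r ≈ʰ map q ∘ʰ map p

    map-irrelevant : ∀ {T T′} (p q : T ⊆ T′) → map p ≈ʰ map q
    map-irrelevant {T′ = T′} p q x =
      Rep.≈ᴹ-trans (M T′) (map-∘ q id p x) (map-id id (⟦ map q ⟧ x))

    -- Collects all cohomological degrees, so that the induction over faces avoids bookkeeping of
    -- cardinalities.
    Chain : Rep G
    Chain = ∏ (Subset q) M

  open Cube

  module _ {G : Group 0ℓ 0ℓ} where

    face : ∀ {q} → Cube G (suc q) → Side → Cube G q
    face C b = record
      { M      = λ T → M C (b ∷ T)
      ; map    = λ p → map C (s⊆s p)
      ; map-id = λ p → map-id C (s⊆s p)
      ; map-∘  = λ p q r → map-∘ C (s⊆s p) (s⊆s q) (s⊆s r)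
      }

    restrict : ∀ {q} (C : Cube G (suc q)) b → Hom (Chain C) (Chain (face C b))
    restrict C b = tuple {M = M (face C b)} λ T → π {M = M C} (b ∷ T)

    record CubeMap {q} (C C′ : Cube G q) : Set where
      field
        at      : ∀ T → Hom (M C T) (M C′ T)
        natural : ∀ {T T′} (p : T ⊆ T′) → at T′ ∘ʰ map C p ≈ʰ map C′ p ∘ʰ at T

    open CubeMap

    faceMap : ∀ {q} {C C′ : Cube G (suc q)} → CubeMap C C′ → ∀ b → CubeMap (face C b) (face C′ b)
    faceMap ψ b = record { at = λ T → at ψ (b ∷ T) ; natural = λ p → natural ψ (s⊆s p) }

    extend : ∀ {q} (C : Cube G (suc q)) → CubeMap (face C outside) (face C inside)
    extend C = record
      { at      = λ T → map C (out⊆ ⊆-refl)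
      -- Both ways round the square are the map of the diagonal inclusion `out⊆ p`.
      ; natural = λ {T} {T′} p x → Rep.≈ᴹ-trans (M C (inside ∷ T′))
          (Rep.≈ᴹ-sym (M C (inside ∷ T′)) (map-∘ C (s⊆s p) (out⊆ ⊆-refl) (out⊆ p) x))
          (map-∘ C (out⊆ ⊆-refl) (s⊆s p) (out⊆ p) x)
      }

    -- The total complex of a cube is the cone of the chain map between its two faces.
    D : ∀ {q} (C : Cube G q) T → Hom (Chain C) (M C T)
    D C []            = 0ʰ
    D C (outside ∷ T) = D (face C outside) T ∘ʰ restrict C outside
    D C (inside ∷ T)  = at (extend C) T ∘ʰ π {M = M C} (outside ∷ T)
                        +ʰ (K.- K.1#) ·ʰ (D (face C inside) T ∘ʰ restrict C inside)

    -- `D C T` reads its argument only at sets with one element fewer than `T`.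
    D-zero : ∀ {q} (C : Cube G q) T {x} →
             (∀ S → suc ∣ S ∣ ≡ ∣ T ∣ → M C S [ x S ≈ Rep.0ᴹ (M C S) ]) →
             M C T [ ⟦ D C T ⟧ x ≈ Rep.0ᴹ (M C T) ]
    D-zero C []            z = Rep.≈ᴹ-refl (M C [])
    D-zero C (outside ∷ T) z = D-zero (face C outside) T λ S → z (outside ∷ S)
    D-zero C (inside ∷ T)  z = ≈ᴹ-trans
      (+ᴹ-cong
        (≈ᴹ-trans (Hom.⟦⟧-cong (at (extend C) T) (z (outside ∷ T) refl)) (Hom.⟦⟧-0 (at (extend C) T)))
        (≈ᴹ-trans (*ₗ-congˡ (D-zero (face C inside) T λ S p → z (inside ∷ S) (cong suc p))) (*ₗ-zeroʳ _)))
      (+ᴹ-identityˡ 0ᴹ)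
      where open Rep (M C (inside ∷ T))

    applyMap : ∀ {q} {C C′ : Cube G q} → CubeMap C C′ → Hom (Chain C) (Chain C′)
    applyMap {C = C} {C′} ψ = tuple {M = M C′} λ T → at ψ T ∘ʰ π {M = M C} T

    D-natural : ∀ {q} {C C′ : Cube G q} (ψ : CubeMap C C′) T →
                D C′ T ∘ʰ applyMap ψ ≈ʰ at ψ T ∘ʰ D C T
    D-natural {C′ = C′} ψ [] x = Rep.≈ᴹ-sym (M C′ []) (Hom.⟦⟧-0 (at ψ []))
    D-natural ψ (outside ∷ T) x = D-natural (faceMap ψ outside) T (λ T → x (outside ∷ T))
    D-natural {C = C} {C′} ψ (inside ∷ T) x = ≈ᴹ-trans
      (+ᴹ-cong
        (≈ᴹ-sym (natural ψ (out⊆ ⊆-refl) (x (outside ∷ T))))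
        (≈ᴹ-trans (*ₗ-congˡ (D-natural (faceMap ψ inside) T (λ T → x (inside ∷ T))))
          (≈ᴹ-sym (Hom.⟦⟧-*ₗ (at ψ (inside ∷ T)) (K.- K.1#) _))))
      (≈ᴹ-sym (Hom.⟦⟧-+ (at ψ (inside ∷ T)) _ _))
      where open Rep (M C′ (inside ∷ T))

    -- Mirrors the summands of `δ`, with `Chain` in place of `Cochain`.
    part : ∀ {q} (C : Cube G q) T e → Dec (e ∈ T) → Hom (Chain C) (M C T)
    part C T e (yes _) = sign (T ∖ e) e ·ʰ (map C (p─q⊆p T ⁅ e ⁆) ∘ʰ π {M = M C} (T ∖ e))
    part C T e (no _)  = 0ʰ

    -- Links the recursive cone to the signed sum: the first edge gives the face map with sign 1,
    -- and prefixing it to the other edges changes their signs as in `sign-outside` and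
    -- `sign-inside`.
    D-sum : ∀ {q} (C : Cube G q) T → D C T ≈ʰ ∑ʰ λ e → part C T e (e ∈? T)
    D-sum C []            x = Rep.≈ᴹ-refl (M C [])
    D-sum C (outside ∷ T) x = ≈ᴹ-trans (D-sum (face C outside) T (λ T → x (outside ∷ T)))
      (≈ᴹ-trans (∑ʰ-cong (λ e → part (face C outside) T e (e ∈? T)) _ later)
        (≈ᴹ-sym (+ᴹ-identityˡ _)))
      where
      open Rep (M C (outside ∷ T))
      later : ∀ e → ⟦ part (face C outside) T e (e ∈? T) ⟧ (λ T → x (outside ∷ T)) ≈ᴹ
                    ⟦ part C (outside ∷ T) (suc e) (suc e ∈? (outside ∷ T)) ⟧ x
      later e with e ∈? T
      ... | yes _ = *ₗ-cong (K.reflexive (sym (sign-outside (T ∖ e) e)))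
                      (map-irrelevant C (s⊆s (p─q⊆p T ⁅ e ⁆)) (p─q⊆p (outside ∷ T) ⁅ suc e ⁆)
                         (x (outside ∷ (T ∖ e))))
      ... | no _  = ≈ᴹ-refl
    D-sum C (inside ∷ T) x = +ᴹ-cong first (≈ᴹ-trans
      (*ₗ-congˡ (D-sum (face C inside) T (λ T → x (inside ∷ T))))
      (≈ᴹ-trans (scale (λ e → part (face C inside) T e (e ∈? T)))
        (∑ʰ-cong (λ e → (K.- K.1#) ·ʰ part (face C inside) T e (e ∈? T)) _ later)))
      where
      open Rep (M C (inside ∷ T))

      scale : ∀ {k r} {L} (f : Fin k → Hom L (M C (inside ∷ T))) {y} →
              r *ₗ ⟦ ∑ʰ f ⟧ y ≈ᴹ ⟦ ∑ʰ (λ e → r ·ʰ f e) ⟧ y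
      scale {zero}  {r} f = *ₗ-zeroʳ r
      scale {suc k} {r} f = ≈ᴹ-trans (*ₗ-distribˡ r _ _) (+ᴹ-congˡ (scale (f ∘ suc)))

      -- Removing the first edge gives `outside ∷ (T ─ ⊥)`, which equals `outside ∷ T` only
      -- propositionally; a general `S` allows matching on `refl`.
      remove-zero : ∀ S (S≡ : outside ∷ T ≡ S) (p : S ⊆ inside ∷ T) →
                    ⟦ at (extend C) T ⟧ (x (outside ∷ T)) ≈ᴹ ⟦ map C p ⟧ (x S)
      remove-zero _ refl p = map-irrelevant C (out⊆ ⊆-refl) p (x (outside ∷ T))

      first : ⟦ at (extend C) T ⟧ (x (outside ∷ T)) ≈ᴹ
              ⟦ part C (inside ∷ T) zero (zero ∈? (inside ∷ T)) ⟧ x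
      first = ≈ᴹ-trans (remove-zero (outside ∷ (T ─ ⊥)) (cong (outside ∷_) (sym (p─⊥≡p T))) _)
        (≈ᴹ-sym (≈ᴹ-trans (*ₗ-congʳ (K.reflexive (sign-zero (outside ∷ (T ─ ⊥))))) (*ₗ-identityˡ _)))

      later : ∀ e → (K.- K.1#) *ₗ ⟦ part (face C inside) T e (e ∈? T) ⟧ (λ T → x (inside ∷ T)) ≈ᴹ
                    ⟦ part C (inside ∷ T) (suc e) (suc e ∈? (inside ∷ T)) ⟧ x
      later e with e ∈? T
      ... | yes _ = ≈ᴹ-trans (≈ᴹ-sym (*ₗ-assoc _ _ _))
                      (*ₗ-cong (K.reflexive (sym (sign-inside (T ∖ e) e)))
                        (map-irrelevant C (s⊆s (p─q⊆p T ⁅ e ⁆)) (p─q⊆p (inside ∷ T) ⁅ suc e ⁆)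
                           (x (inside ∷ (T ∖ e)))))
      ... | no _  = *ₗ-zeroʳ _

    -- A deletion-contraction certificate of exactness in degrees at least `c`. A 0-dimensional cube
    -- lives in degree 0 alone, whence `suc c` in `point`.
    data Collapsible : ∀ {q} → ℕ → Cube G q → Set₁ where
      point : ∀ {c} {C : Cube G 0} → Collapsible (suc c) C
      loop  : ∀ {q c} {C : Cube G (suc q)} → (∀ T → IsIso (at (extend C) T)) → Collapsible c C
      step  : ∀ {q c} {C : Cube G (suc q)} → Collapsible (suc c) (face C outside) →
              Collapsible c (face C inside) → Collapsible (suc c) C

    Supported : ∀ {q} (C : Cube G q) → ℕ → Rep.Carrierᴹ (Chain C) → Set
    Supported C c x = ∀ T → ∣ T ∣ ℕ.< c → M C T [ x T ≈ Rep.0ᴹ (M C T) ]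

    -- The support of the primitive `a` is tracked because `step` feeds the primitive from the
    -- outside face into the cocycle for the inside face, which has to vanish below degree `c`.
    collapsible⇒exact : ∀ {q c} {C : Cube G q} → Collapsible c C → ∀ x → Supported C c x →
      (∀ T → M C T [ ⟦ D C T ⟧ x ≈ Rep.0ᴹ (M C T) ]) →
      ∃[ a ] (∀ T → M C T [ x T ≈ ⟦ D C T ⟧ a ]) ×
             (∀ T → suc ∣ T ∣ ℕ.< c → M C T [ a T ≈ Rep.0ᴹ (M C T) ])
    collapsible⇒exact {C = C} point x supp cocycle =
      Rep.0ᴹ (Chain C) , (λ { [] → supp [] (s≤s z≤n) }) , λ T _ → Rep.≈ᴹ-refl (M C T)
    collapsible⇒exact {C = C} (loop iso) x supp cocycle = a , exact , asupp
      where
      φ : ∀ T → Hom (M C (outside ∷ T)) (M C (inside ∷ T))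
      φ = at (extend C)
      g : ∀ T → Hom (M C (inside ∷ T)) (M C (outside ∷ T))
      g T = proj₁ (iso T)
      a : Rep.Carrierᴹ (Chain C)
      -- The inside component of `D` at `a` is φ aₒ - D aᵢ; aᵢ = 0 and aₒ = φ⁻¹ xᵢ make it xᵢ. The
      -- outside component follows from φ xₒ = D xᵢ = D (φ aₒ) = φ (D aₒ).
      a (outside ∷ T) = ⟦ g T ⟧ (x (inside ∷ T))
      a (inside ∷ T)  = Rep.0ᴹ (M C (inside ∷ T))
      aₒ : Rep.Carrierᴹ (Chain (face C outside))
      aₒ T = a (outside ∷ T)

      exact : ∀ T → M C T [ x T ≈ ⟦ D C T ⟧ a ]
      exact (outside ∷ T) = begin
        x (outside ∷ T)
          ≈⟨ proj₂ (proj₂ (iso T)) (x (outside ∷ T)) ⟨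
        ⟦ g T ⟧ (⟦ φ T ⟧ (x (outside ∷ T)))
          ≈⟨ Hom.⟦⟧-cong (g T)
               (Negation.x-y≈0⇒x≈y (M C (inside ∷ T)) (cocycle (inside ∷ T))) ⟩
        ⟦ g T ⟧ (⟦ D (face C inside) T ⟧ (λ T → x (inside ∷ T)))
          ≈⟨ Hom.⟦⟧-cong (g T) (Hom.⟦⟧-cong (D (face C inside) T) λ T → proj₁ (proj₂ (iso T)) (x (inside ∷ T))) ⟨
        ⟦ g T ⟧ (⟦ D (face C inside) T ⟧ (⟦ applyMap (extend C) ⟧ aₒ))
          ≈⟨ Hom.⟦⟧-cong (g T) (D-natural (extend C) T aₒ) ⟩
        ⟦ g T ⟧ (⟦ φ T ⟧ (⟦ D (face C outside) T ⟧ aₒ))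
          ≈⟨ proj₂ (proj₂ (iso T)) _ ⟩
        ⟦ D (face C outside) T ⟧ aₒ ∎
        where open SetoidReasoning (Rep.≈ᴹ-setoid (M C (outside ∷ T)))
      exact (inside ∷ T) = ≈ᴹ-sym (≈ᴹ-trans
        (+ᴹ-cong (proj₁ (proj₂ (iso T)) (x (inside ∷ T)))
          (≈ᴹ-trans (*ₗ-congˡ (Hom.⟦⟧-0 (D (face C inside) T))) (*ₗ-zeroʳ _)))
        (+ᴹ-identityʳ _))
        where open Rep (M C (inside ∷ T))

      asupp : ∀ T → suc ∣ T ∣ ℕ.< _ → M C T [ a T ≈ Rep.0ᴹ (M C T) ]
      asupp (outside ∷ T) <c = Rep.≈ᴹ-trans (M C (outside ∷ T))
        (Hom.⟦⟧-cong (g T) (supp (inside ∷ T) <c)) (Hom.⟦⟧-0 (g T))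
      asupp (inside ∷ T)  _  = Rep.≈ᴹ-refl (M C (inside ∷ T))
    collapsible⇒exact {C = C} (step {c = c} outer inner) x supp cocycle
      with collapsible⇒exact outer (λ T → x (outside ∷ T))
             (λ T → supp (outside ∷ T)) (λ T → cocycle (outside ∷ T))
    ... | aₒ , x≈Daₒ , aₒ-supp = a , exact , asupp
      where
      φ : ∀ T → Hom (M C (outside ∷ T)) (M C (inside ∷ T))
      φ = at (extend C)
      module I T = Rep (M C (inside ∷ T))
      Dᵢ : ∀ T → Hom (Chain (face C inside)) (M C (inside ∷ T))
      Dᵢ = D (face C inside)
      xᵢ φaₒ y : Rep.Carrierᴹ (Chain (face C inside))
      xᵢ T = x (inside ∷ T)
      φaₒ = ⟦ applyMap (extend C) ⟧ aₒ
      -- y = xᵢ - φ aₒ is the error left by `aₒ` on the inside face; it is a cocycle since D xᵢ = φ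
      -- xₒ = φ (D aₒ) = D (φ aₒ).
      y = Rep._+ᴹ_ (Chain (face C inside)) xᵢ (Rep._*ₗ_ (Chain (face C inside)) (K.- K.1#) φaₒ)

      y-cocycle : ∀ T → I._≈ᴹ_ T (⟦ Dᵢ T ⟧ y) (I.0ᴹ T)
      y-cocycle T = begin
        ⟦ Dᵢ T ⟧ y
          ≈⟨ Hom.⟦⟧-+ (Dᵢ T) xᵢ _ ⟩
        ⟦ Dᵢ T ⟧ xᵢ +ᴹ ⟦ Dᵢ T ⟧ (Rep._*ₗ_ (Chain (face C inside)) (K.- K.1#) φaₒ)
          ≈⟨ +ᴹ-cong
               (≈ᴹ-sym (Negation.x-y≈0⇒x≈y (M C (inside ∷ T)) (cocycle (inside ∷ T))))
               (Hom.⟦⟧-*ₗ (Dᵢ T) (K.- K.1#) φaₒ) ⟩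
        ⟦ φ T ⟧ (x (outside ∷ T)) +ᴹ (K.- K.1#) *ₗ ⟦ Dᵢ T ⟧ φaₒ
          ≈⟨ +ᴹ-congˡ (*ₗ-congˡ (D-natural (extend C) T aₒ)) ⟩
        ⟦ φ T ⟧ (x (outside ∷ T)) +ᴹ (K.- K.1#) *ₗ ⟦ φ T ⟧ (⟦ D (face C outside) T ⟧ aₒ)
          ≈⟨ +ᴹ-congˡ (*ₗ-congˡ (Hom.⟦⟧-cong (φ T) (x≈Daₒ T))) ⟨
        ⟦ φ T ⟧ (x (outside ∷ T)) +ᴹ (K.- K.1#) *ₗ ⟦ φ T ⟧ (x (outside ∷ T))
          ≈⟨ Negation.y-y≈0 (M C (inside ∷ T)) _ ⟩
        0ᴹ ∎
        where
        open Rep (M C (inside ∷ T))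
        open SetoidReasoning ≈ᴹ-setoid

      y-supp : Supported (face C inside) c y
      y-supp T T<c = ≈ᴹ-trans
        (+ᴹ-cong (supp (inside ∷ T) (s≤s T<c))
          (≈ᴹ-trans (*ₗ-congˡ (≈ᴹ-trans (Hom.⟦⟧-cong (φ T) (aₒ-supp T (s≤s T<c))) (Hom.⟦⟧-0 (φ T))))
            (*ₗ-zeroʳ _)))
        (+ᴹ-identityˡ 0ᴹ)
        where open Rep (M C (inside ∷ T))

      rec = collapsible⇒exact inner y y-supp y-cocycle
      b = proj₁ rec

      a : Rep.Carrierᴹ (Chain C)
      a (outside ∷ T) = aₒ T
      -- The cone carries -D on the inside face, so the primitive `b` of `y` enters negated: φ aₒ -
      -- D (-b) = φ aₒ + y = xᵢ.
      a (inside ∷ T)  = I._*ₗ_ T (K.- K.1#) (b T)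

      exact : ∀ T → M C T [ x T ≈ ⟦ D C T ⟧ a ]
      exact (outside ∷ T) = x≈Daₒ T
      exact (inside ∷ T)  = ≈ᴹ-sym (begin
        φaₒ T +ᴹ (K.- K.1#) *ₗ ⟦ Dᵢ T ⟧ (λ T → I._*ₗ_ T (K.- K.1#) (b T))
          ≈⟨ +ᴹ-congˡ (*ₗ-congˡ (Hom.⟦⟧-*ₗ (Dᵢ T) (K.- K.1#) b)) ⟩
        φaₒ T +ᴹ (K.- K.1#) *ₗ ((K.- K.1#) *ₗ ⟦ Dᵢ T ⟧ b)  ≈⟨ +ᴹ-congˡ (-‿involutive _) ⟩
        φaₒ T +ᴹ ⟦ Dᵢ T ⟧ b                            ≈⟨ +ᴹ-congˡ (proj₁ (proj₂ rec) T) ⟨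
        φaₒ T +ᴹ (xᵢ T +ᴹ (K.- K.1#) *ₗ φaₒ T)                ≈⟨ +ᴹ-comm _ _ ⟩
        (xᵢ T +ᴹ (K.- K.1#) *ₗ φaₒ T) +ᴹ φaₒ T                ≈⟨ x-y+y≈x (xᵢ T) (φaₒ T) ⟩
        xᵢ T                                                 ∎)
        where
        open Rep (M C (inside ∷ T))
        open Negation (M C (inside ∷ T))
        open SetoidReasoning ≈ᴹ-setoid

      asupp : ∀ T → suc ∣ T ∣ ℕ.< suc c → M C T [ a T ≈ Rep.0ᴹ (M C T) ]
      asupp (outside ∷ T) <c       = aₒ-supp T <c
      asupp (inside ∷ T)  (s≤s <c) = I.≈ᴹ-trans T (I.*ₗ-congˡ T (proj₂ (proj₂ rec) T <c)) (I.*ₗ-zeroʳ T _)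

  -- Deletion and contraction

  -- Connectedness through `T` after contracting the classes of `R`, expressed on the original
  -- vertices.
  Linked : ∀ {n q} (R : Fin n → Fin n → Set) (edge : Fin q → Subset n) (T : Subset q) → Fin n → Fin n → Set
  Linked R edge T = Star λ u v → R u v ⊎ Adjacent edge T u v

  -- `T′` enters through an equation because `inside ∷ T` is `(outside ∷ T) ∪ ⁅ zero ⁆` only
  -- propositionally.
  IsoOnCycles : ∀ {n q} {G : Group 0ℓ 0ℓ} → (Fin n → Fin n → Set) → (Fin q → Subset n) → Cube G q → Set
  IsoOnCycles R edge C = ∀ {T T′ e} → e ∉ T → T′ ≡ T ∪ ⁅ e ⁆ →
    (∀ {u v} → u ∈ edge e → v ∈ edge e → Linked R edge T u v) → (p : T ⊆ T′) → IsIso (Cube.map C p)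

  -- Deleting the first edge and contracting it are the two faces of the cube; a contraction
  -- lowers the number n − ∣nonleast R∣ of remaining vertices by at least one.
  collapsible : ∀ {n q} {G : Group 0ℓ 0ℓ} (C : Cube G q) (edge : Fin q → Subset (suc n))
    {R : Fin (suc n) → Fin (suc n) → Set} (R-isDecEq : IsDecEquivalence R) → IsoOnCycles R edge C →
    ∀ c → suc n ℕ.≤ c ℕ.+ ∣ nonleast (IsDecEquivalence._≟_ R-isDecEq) ∣ → Collapsible c C
  collapsible C edge isDecEq iso zero n≤ =
    -- For c = 0 the bound would make every vertex non-least.
    contradiction n≤ (ℕ.<⇒≱ (∣nonleast∣<n (IsDecEquivalence._≟_ isDecEq)))
  collapsible {q = zero} C edge isDecEq iso (suc c) n≤ = point
  collapsible {n} {suc q} C edge {R} isDecEq iso (suc c) n≤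
    with Fin.any? (λ u → Fin.any? λ v → u ∈? edge zero ×-dec v ∈? edge zero ×-dec ¬? (u R.≟ v))
    where module R = IsDecEquivalence isDecEq
  -- All vertices of the first edge are `R`-related, so it is a loop in the contracted graph.
  ... | no none = loop λ T → iso (λ ()) (cong (inside ∷_) (sym (∪-identityʳ T)))
    (λ {u} {v} u∈ v∈ → inj₁ (decidable-stable (IsDecEquivalence._≟_ isDecEq u v)
      λ ¬Ruv → none (u , v , u∈ , v∈ , ¬Ruv)) ◅ stop) _
  ... | yes (u , v , u∈ , v∈ , ¬Ruv) = step
    (collapsible (face C outside) (edge ∘ suc) isDecEq delete (suc c) n≤)
    (collapsible (face C inside) (edge ∘ suc) (merge-isDecEquivalence isDecEq (edge zero)) contract c
      (ℕ.≤-trans n≤ (ℕ.≤-trans (ℕ.≤-reflexive (sym (ℕ.+-suc c _)))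
        (ℕ.+-monoʳ-≤ c (p⊂q⇒∣p∣<∣q∣ (nonleast-merge-⊂ isDecEq (edge zero) u∈ v∈ ¬Ruv))))))
    where
    later : ∀ {b T u v} → Adjacent (edge ∘ suc) T u v → Adjacent edge (b ∷ T) u v
    later (e , e∈T , u∈ , v∈) = suc e , there e∈T , u∈ , v∈

    delete : IsoOnCycles R (edge ∘ suc) (face C outside)
    delete e∉T eq links p = iso (e∉T ∘ drop-there) (cong (outside ∷_) eq)
      (λ u∈ v∈ → Star.map (map₂ later) (links u∈ v∈)) (s⊆s p)

    contract : IsoOnCycles (Merge isDecEq (edge zero)) (edge ∘ suc) (face C inside)
    contract e∉T eq links p = iso (e∉T ∘ drop-there) (cong (inside ∷_) eq)
      (λ u∈ v∈ → Star.concat (Star.map unmerge (links u∈ v∈))) (s⊆s p)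
      where
      unmerge : ∀ {T u v} → Merge isDecEq (edge zero) u v ⊎ Adjacent (edge ∘ suc) T u v →
                Linked R edge (inside ∷ T) u v
      unmerge (inj₁ (inj₁ Ruv)) = inj₁ Ruv ◅ stop
      -- A merging step unfolds to a walk: reach the contracted edge within the class of `u`, cross
      -- it, and move on within the class of `v`.
      unmerge (inj₁ (inj₂ ((x , Rux , x∈) , (y , Rvy , y∈)))) =
        inj₁ Rux ◅ inj₂ (zero , here , x∈ , y∈) ◅ inj₁ (IsDecEquivalence.sym isDecEq Rvy) ◅ stop
      unmerge (inj₂ adj) = inj₂ (later adj) ◅ stop

  -- Cohomology of the chromatic symmetric complex

  exact⇒Homology-zero : ∀ {G} {L M N : Rep G} (f : Hom L M) (g : Hom M N) →
    (∀ x → N [ ⟦ g ⟧ x ≈ Rep.0ᴹ N ] → ∃[ a ] M [ x ≈ ⟦ f ⟧ a ]) → Rep.IsZero (Homology f g)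
  exact⇒Homology-zero {M = M} f g exact (x , gx≈0) =
    let a , x≈fa = exact x gx≈0 in a , ≈ᴹ-trans x≈fa (≈ᴹ-sym (+ᴹ-identityˡ _))
    where open Rep M

  Homology-zero : ∀ {G} {L M N : Rep G} (f : Hom L M) (g : Hom M N) → Rep.IsZero M → Rep.IsZero (Homology f g)
  Homology-zero {L = L} {M} f g z = exact⇒Homology-zero f g λ x _ →
    Rep.0ᴹ L , ≈ᴹ-trans (z x) (≈ᴹ-sym (z _))
    where open Rep M

  module _ {n : ℕ} {G : Graph n} (F : ChromaticSymmetricFunctor G) where
    open Graph G
    open ChromaticSymmetricFunctor F

    cube : ℤ → Cube (Sym n) m
    cube j = record
      { M      = F₀ F j
      ; map    = λ p → F₁ p j
      ; map-id = λ p → identity p j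
      ; map-∘  = λ p q r → compose p q r j
      }

    𝓜-≡-isIso : ∀ {P Q : List (Subset n)} (P≡Q : P ≡ Q) j → IsIso (𝓜-≡ P≡Q j)
    𝓜-≡-isIso {P} refl j = idʰ , (λ _ → Rep.≈ᴹ-refl (𝓜 P j)) , (λ _ → Rep.≈ᴹ-refl (𝓜 P j))

    isIso-resp-≈ʰ : ∀ {M N : Rep (Sym n)} (f g : Hom M N) → f ≈ʰ g → IsIso g → IsIso f
    isIso-resp-≈ʰ {M} {N} f g f≈g (h , gh≈1 , hg≈1) = h
      , (λ y → Rep.≈ᴹ-trans N (f≈g (⟦ h ⟧ y)) (gh≈1 y))
      , (λ x → Rep.≈ᴹ-trans M (Hom.⟦⟧-cong h (f≈g x)) (hg≈1 x))

    -- With equality as `R`, a `Linked` walk is a `Joined` walk, so the cycle law of the functor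
    -- identifies the map with a transported identity.
    cube-isoOnCycles : ∀ j → IsoOnCycles _≡_ edge (cube j)
    cube-isoOnCycles j {T} {e = e} e∉T refl links p =
      isIso-resp-≈ʰ (F₁ p j) (𝓜-≡ eq j) (cycle e∉T cyc p j) (𝓜-≡-isIso eq j)
      where
      cyc : CompletesCycle G T e
      cyc u∈ v∈ = Star.concat (Star.map (λ { (inj₁ refl) → stop ; (inj₂ adj) → adj ◅ stop }) (links u∈ v∈))
      eq = completesCycle⇒blocks≡ G {T} {e} cyc

    module _ (j : ℤ) where
      private
        C = cube j
        module M T = Rep (F₀ F j T)

      Extends : ∀ i → (∀ T → M.Carrierᴹ T) → Rep.Carrierᴹ (Cochain F i j) → Set
      Extends i y x = ∀ T .(T≡i : + ∣ T ∣ ≡ i) → M._≈ᴹ_ T (y T) (x (T , [ T≡i ]))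

      -- By `D-sum` both sides have the same summands; these read only the sets `T ∖ e`, all of size
      -- i, where `y` and `x` agree.
      δ-D : ∀ i {i′} (i′≡1+i : i′ ≡ ℤ.suc i) {y x} → Extends i y x → ∀ T .(T≡i′ : + ∣ T ∣ ≡ i′) →
            M._≈ᴹ_ T (⟦ δ F i i′≡1+i j ⟧ x (T , [ T≡i′ ])) (⟦ D C T ⟧ y)
      δ-D i i′≡1+i {y} {x} ext T T≡i′ = M.≈ᴹ-trans T
        (∑ʰ-cong {N = F₀ F j T} (proj₁ family) (λ e → part C T e (e ∈? T)) termwise)
        (M.≈ᴹ-sym T (D-sum C T y))
        where
        -- Recovers by unification the summands of δ, which are local to its definition.
        family : Σ[ h ∈ (Fin m → Hom (Cochain F i j) (F₀ F j T)) ]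
                 ⟦ δ F i i′≡1+i j ⟧ x (T , [ T≡i′ ]) ≡ ⟦ ∑ʰ h ⟧ x
        family = _ , refl

        termwise : ∀ e → M._≈ᴹ_ T (⟦ proj₁ family e ⟧ x) (⟦ part C T e (e ∈? T) ⟧ y)
        termwise e with e ∈? T
        ... | yes e∈T = M.*ₗ-congˡ T (Hom.⟦⟧-cong (F₁ (p─q⊆p T ⁅ e ⁆) j)
          (M.≈ᴹ-sym (T ∖ e) (ext (T ∖ e) (remove T (trans T≡i′ i′≡1+i) e∈T))))
        ... | no _    = M.≈ᴹ-refl T

      extendByZero : ∀ i → Rep.Carrierᴹ (Cochain F i j) → ∀ T → M.Carrierᴹ T
      extendByZero i x T with + ∣ T ∣ ℤ.≟ i
      ... | yes T≡i = x (T , [ T≡i ])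
      ... | no _    = M.0ᴹ T

      extendByZero-extends : ∀ i x → Extends i (extendByZero i x) x
      extendByZero-extends i x T T≡i with + ∣ T ∣ ℤ.≟ i
      ... | yes _  = M.≈ᴹ-refl T
      ... | no T≢i = ⊥-elim (T≢i T≡i)

      extendByZero-≢ : ∀ i x T → + ∣ T ∣ ≢ i → M._≈ᴹ_ T (extendByZero i x T) (M.0ᴹ T)
      extendByZero-≢ i x T T≢i with + ∣ T ∣ ℤ.≟ i
      ... | yes T≡i = contradiction T≡i T≢i
      ... | no _    = M.≈ᴹ-refl T

      -- Where |T| = i + 1 this is the cocycle condition on `x`; in every other degree `D` reads
      -- only zeros.
      extendByZero-cocycle : ∀ i x →
                             Cochain F (ℤ.suc i) j [ ⟦ δ F i refl j ⟧ x ≈ Rep.0ᴹ (Cochain F (ℤ.suc i) j) ] →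
                             ∀ T → M._≈ᴹ_ T (⟦ D C T ⟧ (extendByZero i x)) (M.0ᴹ T)
      extendByZero-cocycle i x δx≈0 T = degree (+ ∣ T ∣ ℤ.≟ ℤ.suc i)
        where
        degree : Dec (+ ∣ T ∣ ≡ ℤ.suc i) → M._≈ᴹ_ T (⟦ D C T ⟧ (extendByZero i x)) (M.0ᴹ T)
        degree (yes T≡1+i) = M.≈ᴹ-trans T
          (M.≈ᴹ-sym T (δ-D i refl (extendByZero-extends i x) T T≡1+i)) (δx≈0 (T , [ T≡1+i ]))
        degree (no T≢1+i)  = D-zero C T λ S 1+S≡T → extendByZero-≢ i x S λ S≡i →
          T≢1+i (trans (cong +_ (sym 1+S≡T)) (cong ℤ.suc S≡i))

  module _ {n : ℕ} {G : Graph (suc n)} (F : ChromaticSymmetricFunctor G) where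
    open Graph G

    -- At the start nothing is contracted: `R` is equality and `c` is the number of vertices. The
    -- primitive of the extension by zero, read in degree i - 1, is the required cochain.
    δ-exact : ∀ {i} j → suc n ℕ.≤ i → ∀ x →
      Cochain F (ℤ.suc (+ i)) j [ ⟦ δ F (+ i) refl j ⟧ x ≈ Rep.0ᴹ (Cochain F (ℤ.suc (+ i)) j) ] →
      ∃[ a ] Cochain F (+ i) j [ x ≈ ⟦ δ F (ℤ.pred (+ i)) (sym (ℤ.suc-pred (+ i))) j ⟧ a ]
    δ-exact {i} j n<i x δx≈0 =
      let a , x̂≈Da , _ = collapsible⇒exact
            (collapsible (cube F j) edge Fin.≡-isDecEquivalence (cube-isoOnCycles F j)
              (suc n) (ℕ.m≤m+n (suc n) _))
            (extendByZero F j (+ i) x)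
            (λ T T≤n → extendByZero-≢ F j (+ i) x T λ T≡i → ℕ.<⇒≢ (ℕ.<-≤-trans T≤n n<i) (ℤ.+-injective T≡i))
            (extendByZero-cocycle F j (+ i) x δx≈0)
      in (λ (T , _) → a T) , λ (T , [ T≡i ]) →
        let open Rep (F₀ F j T) in
        ≈ᴹ-trans (≈ᴹ-sym (extendByZero-extends F j (+ i) x T T≡i))
        (≈ᴹ-trans (x̂≈Da T)
        (≈ᴹ-sym (δ-D F j (ℤ.pred (+ i)) (sym (ℤ.suc-pred (+ i))) (λ T _ → ≈ᴹ-refl′ T) T T≡i)))
      where
      ≈ᴹ-refl′ : ∀ T {y} → F₀ F j T [ y ≈ y ]
      ≈ᴹ-refl′ T = Rep.≈ᴹ-refl (F₀ F j T)

    Cochain-zero⇒H^CS-zero : ∀ i j → (∀ T → + ∣ T ∣ ≡ i → Rep.IsZero (F₀ F j T)) → Rep.IsZero (H^CS F i j)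
    Cochain-zero⇒H^CS-zero i j z = Homology-zero (δ F (ℤ.pred i) (sym (ℤ.suc-pred i)) j) (δ F i refl j)
      -- `OfSize` stores the size proof irrelevantly; deciding the equation recovers it.
      λ x (T , [ T≡i ]) → z T (recompute (+ ∣ T ∣ ℤ.≟ i) T≡i) (x (T , [ T≡i ]))

    -- The graph has n + 1 vertices here. For i < 0 there are no edge sets, for j < 0 or j > i the
    -- modules vanish, and for i > n the complex is exact.
    H^CS-support : ∀ i j → ¬ ((0ℤ ℤ.≤ i × i ℤ.≤ + n) × (0ℤ ℤ.≤ j × j ℤ.≤ i)) → Rep.IsZero (H^CS F i j)
    H^CS-support -[1+ i ] j        _   = Cochain-zero⇒H^CS-zero -[1+ i ] j λ _ ()
    H^CS-support (+ i)    -[1+ j ] _   = Cochain-zero⇒H^CS-zero (+ i) -[1+ j ] λ T _ → 𝓜-zero-below (blocks G T) j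
    H^CS-support (+ i)    (+ j)    out = cases (suc n ℕ.≤? i) (j ℕ.≤? i)
      where
      cases : Dec (suc n ℕ.≤ i) → Dec (j ℕ.≤ i) → Rep.IsZero (H^CS F (+ i) (+ j))
      cases (yes n<i) _         = exact⇒Homology-zero
        (δ F (ℤ.pred (+ i)) (sym (ℤ.suc-pred (+ i))) (+ j)) (δ F (+ i) refl (+ j)) (δ-exact (+ j) n<i)
      cases (no n≮i)  (yes j≤i) = contradiction
        ((ℤ.+≤+ z≤n , ℤ.+≤+ (ℕ.≮⇒≥ n≮i)) , (ℤ.+≤+ z≤n , ℤ.+≤+ j≤i)) out
      cases (no _)    (no j≰i)  = Cochain-zero⇒H^CS-zero (+ i) (+ j) λ T T≡i →
        𝓜-zero-above G T (subst (ℕ._< j) (sym (ℤ.+-injective T≡i)) (ℕ.≰⇒> j≰i))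

open import Defs

corollary6p6 : ∀ {n : ℕ} (G : Graph n) → Connected G →
    (F : ChromaticSymmetricFunctor G) (i j : ℤ) →
    ¬ ((0ℤ ≤ i × i ≤ + n - 1ℤ) × (0ℤ ≤ j × j ≤ i)) →
    Rep.IsZero (H^CS F i j)
corollary6p6 {zero}  G connected = contradiction (Connected.nonempty connected) λ ()
-- `+ suc n - 1ℤ` evaluates to `+ n`, the bound in `H^CS-support`.
corollary6p6 {suc n} G connected = H^CS-support ℂ
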